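{- Consider the linear matroid secretary problem on a laminar matroid $\mathcal{M}=(U,\mathcal{I})$ with non-negative element weights $w(e)$, where the value of a set is $f(T)=\sum_{e\in T}w(e)$. There is a choice of $p\in(0,1)$ for which the algorithm ONLINE is $9.6$-competitive, i.e. $\mathbb{E}[f(\mathrm{ALG})]\ge \frac{1}{9.6}\max_{T\in\mathcal{I}}f(T)$ for all non-negative weights. ONLINE with parameter $p$ works as follows: let $n=|U|$; draw $m\sim\mathrm{Binom}(n,p)$; observe the first $m$ arriving elements, forming the set $H$, without accepting any; then, for each subsequent arriving element $e$, if $\mathrm{GREEDY}(H\cup\{e\})\ne\mathrm{GREEDY}(H)$ and $\mathrm{ALG}\cup\{e\}\in\mathcal{I}$, accept $e$ (add it to $\mathrm{ALG}$, initially empty); otherwise reject it. Here $\mathrm{GREEDY}(X)$ starts with $T=\emptyset$ and, as long as some $e\in X\setminus T$ satisfies $T\cup\{e\}\in\mathcal{I}$, adds to $T$ such an $e$ maximizing $f(T\cup\{e\})-f(T)$, and finally returns $T$.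
   Context: Linear matroid secretary problem: elements of a finite ground set $U$ arrive in uniformly random order; an adversary has fixed non-negative weights, and the weight of an element is revealed upon arrival; the algorithm must immediately and irrevocably accept or reject each arriving element, keeping the accepted set independent in the matroid; it is $C$-competitive if the expected total weight of accepted elements is at least $1/C$ times the maximum weight of an independent set (expectation over arrival order and internal randomness). Laminar matroid: given a laminar family $\mathcal{F}$ of subsets of $U$ (any two members disjoint or nested) with non-negative integer capacities $\mu(B)$, $T\subseteq U$ is independent iff $|T\cap B|\le\mu(B)$ for all $B\in\mathcal{F}$.
   Formalization: The element weights w(e) are non-negative rational numbers instead of non-negative reals (p is also found rational, namely 5/6); ties in GREEDY are broken by a fixed order of the elements. -}

module Defs where

open import Data.Bool using (Bool; true; false; if_then_else_; not; _∧_)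
open import Data.Nat as ℕ using (ℕ; zero; suc; _!; _∸_)
open import Data.Nat.Properties using (_!≢0)
open import Data.Nat.Combinatorics using (_C_)
open import Data.Integer using (+_)
open import Data.Rational using (ℚ; 0ℚ; 1ℚ; _+_; _*_; _-_; _/_; _≤_)
open import Data.Rational.Properties using (_≤?_)
open import Data.Fin using (Fin)
open import Data.Fin.Subset using (Subset; _∩_; _∪_; ∣_∣; _∈_; _⊆_; Empty; ⁅_⁆; ⊥)
open import Data.Fin.Subset.Properties using (_∈?_)
open import Data.List using (List; []; _∷_; map; concatMap; foldl; filter; take; drop; upTo; allFin)
open import Data.List.Relation.Unary.All using (All; all?)
open import Data.Product using (_×_; _,_; proj₁; proj₂)
open import Data.Sum using (_⊎_)
open import Data.Maybe using (Maybe; just; nothing)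
open import Data.Vec.Properties using (≡-dec)
import Data.Bool.Properties as BoolP
open import Relation.Nullary using (does; ¬_)
open import Relation.Binary.PropositionalEquality using (_≡_)

-- A member of the family: a subset B of U together with its capacity μ(B).
Constraint : ℕ → Set
Constraint n = Subset n × ℕ

DisjointOrNested : ∀ {n} → Subset n → Subset n → Set
DisjointOrNested A B = Empty (A ∩ B) ⊎ (A ⊆ B ⊎ B ⊆ A)

record Laminar (n : ℕ) : Set where
  field
    family  : List (Constraint n)
    laminar : All (λ c → All (λ d → DisjointOrNested (proj₁ c) (proj₁ d)) family) family
open Laminar public

Independent : ∀ {n} → Laminar n → Subset n → Set
Independent L T = All (λ c → ∣ T ∩ proj₁ c ∣ ℕ.≤ proj₂ c) (family L)

independent? : ∀ {n} → Laminar n → Subset n → Bool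
independent? L T = does (all? (λ c → ∣ T ∩ proj₁ c ∣ ℕ.≤? proj₂ c) (family L))

Weights : ℕ → Set
Weights n = Fin n → ℚ

f : ∀ {n} → Weights n → Subset n → ℚ
f {n} w T = foldl (λ acc e → acc + (if does (e ∈? T) then w e else 0ℚ)) 0ℚ (allFin n)

-- Among a list of candidates, pick one maximising the weight; ties are
-- broken in favour of the earliest candidate in the list.
best : ∀ {n} → Weights n → List (Fin n) → Maybe (Fin n)
best w [] = nothing
best w (e ∷ es) with best w es
... | nothing = just e
... | just e' = if does (w e' ≤? w e) then just e else just e'

candidates : ∀ {n} → Laminar n → Subset n → Subset n → List (Fin n)
candidates {n} L X T =
  filter (λ e → (e ∈? X) Relation.Nullary.×-dec (Relation.Nullary.¬? (e ∈? T)))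
         (allFin n)
  where import Relation.Nullary

greedyLoop : ∀ {n} → ℕ → Laminar n → Weights n → Subset n → Subset n → Subset n
greedyLoop zero L w X T = T
greedyLoop (suc k) L w X T
  with best w (filter (λ e → Data.Bool._≟_ (independent? L (T ∪ ⁅ e ⁆)) true) (candidates L X T))
  where import Data.Bool
... | nothing = T
... | just e  = greedyLoop k L w X (T ∪ ⁅ e ⁆)

-- GREEDY(X): at most n elements can ever be added, so n iterations suffice.
-- The marginal gain f(T ∪ {e}) − f(T) of e ∉ T equals w(e).
GREEDY : ∀ {n} → Laminar n → Weights n → Subset n → Subset n
GREEDY {n} L w X = greedyLoop n L w X ⊥

toSet : ∀ {n} → List (Fin n) → Subset n
toSet = foldl (λ S e → S ∪ ⁅ e ⁆) ⊥

ONLINE : ∀ {n} → Laminar n → Weights n → List (Fin n) → ℕ → Subset n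
ONLINE {n} L w σ m = foldl step ⊥ (drop m σ)
  where
  H : Subset n
  H = toSet (take m σ)
  step : Subset n → Fin n → Subset n
  step ALG e =
    if not (does (≡-dec BoolP._≟_ (GREEDY L w (H ∪ ⁅ e ⁆)) (GREEDY L w H)))
       ∧ independent? L (ALG ∪ ⁅ e ⁆)
    then ALG ∪ ⁅ e ⁆ else ALG

insertions : ∀ {A : Set} → A → List A → List (List A)
insertions x [] = (x ∷ []) ∷ []
insertions x (y ∷ ys) = (x ∷ y ∷ ys) ∷ map (y ∷_) (insertions x ys)

permutations : ∀ {A : Set} → List A → List (List A)
permutations [] = [] ∷ []
permutations (x ∷ xs) = concatMap (insertions x) (permutations xs)

sumℚ : List ℚ → ℚ
sumℚ = foldl _+_ 0ℚ

_^ℚ_ : ℚ → ℕ → ℚ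
q ^ℚ zero = 1ℚ
q ^ℚ suc k = q * (q ^ℚ k)

fromℕℚ : ℕ → ℚ
fromℕℚ k = + k / 1

binom : ℚ → ℕ → ℕ → ℚ
binom p n m = fromℕℚ (n C m) * ((p ^ℚ m) * ((1ℚ - p) ^ℚ (n ∸ m)))

-- E[f(ALG)] for ONLINE with parameter p: average over the n! arrival
-- orders, and over m ~ Binom(n, p) (independent of the order).
expectedValue : ∀ {n} → ℚ → Laminar n → Weights n → ℚ
expectedValue {n} p L w =
  (+ 1 / (n !)) {{n !≢0}} *
  sumℚ (map (λ σ → sumℚ (map (λ m → binom p n m * f w (ONLINE L w σ m)) (upTo (suc n))))
            (permutations (allFin n)))

{-# OPTIONS --safe #-}

-- The theorem holds with p = 5/6 (put q = 1/6). Since m is binomial, every element lands in the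
-- sample H independently with probability p. Process the elements by decreasing weight, and call x
-- addable if x ∉ H and the greedy solution on the elements of H before x can be extended by x; for
-- x ∉ H this means that adding x to H changes GREEDY. An element e of the offline greedy optimum is
-- spanned by no set of its predecessors, so it is addable whenever e ∉ H, independently of all other
-- elements. It is then accepted unless some member B ∋ e of capacity μ contains μ further addable
-- elements. While B is scanned, every element that still fits is a head (in H) with probability p or
-- an addable tail, and at most μ heads occur, so this requires μ tails before μ heads.
-- For each μ only the largest member through e of capacity μ matters. The probabilities of μ tails
-- before μ heads sum to at most 3/8 over μ ≥ 1, so e is accepted with probability at least
-- q (1 - 3/8) = 5/48.
module Submission where

open import Defs
open import Data.Bool as Bool using (true; if_then_else_; not; _∧_)
import Data.Bool.Properties as BoolP
open import Data.Fin using (Fin; zero; suc)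
import Data.Fin.Properties as FinP
open import Data.Fin.Subset using (Subset; _∩_; _∪_; _─_; ∣_∣; _∈_; _∉_; _⊆_; ⁅_⁆; ⊥; ⊤; inside; outside)
open import Data.Fin.Subset.Properties using (_∈?_; _⊆?_; ∉⊥; ∈⊤; x∈⁅x⁆; x∈⁅y⁆⇒x≡y; p⊆q⇒∣p∣≤∣q∣; ⊆-antisym; drop-∷-⊆; x∈p∩q⁺; x∈p∩q⁻; x∈p∪q⁺; x∈p∪q⁻; p⊆p∪q; x∈p∧x∉q⇒x∈p─q; p─q⊆p; ∣⊥∣≡0; ∪-identityʳ; ∪-assoc; ∪-comm; ∩-identityʳ; ∩-zeroˡ; ∩-zeroʳ)
open import Data.Integer using (+_)
import Data.Integer as ℤ
import Data.Integer.Properties as ℤP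
open import Data.List using (List; []; _∷_; _++_; map; concatMap; filter; foldl; length; take; drop; upTo; applyUpTo; downFrom; allFin)
open import Data.List.Membership.Propositional using (find; lose) renaming (_∈_ to _∈ˡ_; _∉_ to _∉ˡ_)
open import Data.List.Membership.Propositional.Properties using (∈-map⁺; ∈-map⁻; ∈-filter⁻; ∈-allFin; ∈-concatMap⁻; ∈-upTo⁻; ∈-∃++; ∈-++⁻; ∈-++⁺ˡ; ∈-++⁺ʳ)
open import Data.List.Properties using (filter-all; length-tabulate; foldl-++; take++drop≡id)
open import Data.List.Relation.Binary.Permutation.Propositional as Perm using (_↭_; prep; swap; ↭-trans; ↭-sym; ↭⇒↭ₛ)
open import Data.List.Relation.Binary.Permutation.Propositional.Properties using (↭-length; ∈-resp-↭; shift)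
import Data.List.Relation.Binary.Permutation.Setoid.Properties as PermSetoid
open import Data.List.Relation.Unary.All as All using (All; []; _∷_; all?)
open import Data.List.Relation.Unary.All.Properties using (¬All⇒Any¬)
open import Data.List.Relation.Unary.AllPairs using ([]; _∷_)
open import Data.List.Relation.Unary.Any using (here; there; any?)
open import Data.List.Relation.Unary.Unique.Propositional using (Unique)
open import Data.List.Relation.Unary.Unique.Propositional.Properties using (allFin⁺; filter⁺)
open import Data.Maybe using (just; nothing)
open import Data.Maybe.Properties using (just-injective)
open import Data.Nat as ℕ using (ℕ; zero; suc; z≤n; s≤s; pred; _∸_; _!)
open import Data.Nat.Combinatorics using (_C_; nCk≡n!/k![n-k]!; k![n∸k]!∣n!)
import Data.Nat.DivMod as DivMod
import Data.Nat.Properties as ℕP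
open import Data.Product using (Σ; ∃; _×_; _,_; proj₁; proj₂)
open import Data.Rational using (ℚ; 0ℚ; 1ℚ; _+_; _*_; _-_; -_; _/_; _≤_; _<_; nonNegative; toℚᵘ)
import Data.Rational.Properties as ℚP
open import Data.Rational.Solver using (module +-*-Solver)
open import Data.Rational.Unnormalised as ℚᵘ using (mkℚᵘ; *≡*)
import Data.Rational.Unnormalised.Properties as ℚᵘP
open import Data.Sum using (_⊎_; inj₁; inj₂)
open import Data.Vec using ([]; _∷_; here; there)
open import Data.Vec.Properties using (≡-dec)
open import Function using (_∘_; id)
open import Relation.Binary.PropositionalEquality using (_≡_; _≢_; refl; sym; trans; cong; cong₂; subst; setoid; module ≡-Reasoning)
open import Relation.Nullary using (Dec; does; yes; no; ¬_; contradiction; _×-dec_; ¬?)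
open import Relation.Nullary.Decidable using (from-yes; dec-true; dec-false)
open import Relation.Unary using (Decidable)

-- Whether `e` is accepted depends on the arrival order after the sample and on earlier acceptances,
-- while the coin argument sees only the sample set. The bridge is a pessimistic count: every
-- addable element other than `e` is treated as accepted before `e`. The resulting bound `accept` is
-- a function of the sample alone and holds for each arrival order separately. Competitors are found
-- by scanning the order without `e`; this loses none of them when `e` is unsampled, and makes their
-- number independent of the coin of `e`. The failure events for different capacities are not
-- independent, so a union bound combines them. One event per capacity keeps its sum bounded: the
-- chain of members through `e` may repeat a capacity arbitrarily often, while the probabilities for
-- distinct capacities are bounded by a geometric series of ratio `4pq`. The choice of `q` balances
-- the chance `q` of escaping the sample against that sum, and `5/48` is `1/9.6`.

private
  variable
    n : ℕ
    x y : Fin n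
    B : Subset n
    A : Set

-- Laminar matroids and the greedy scan

∈-add⁺ : ∀ (T : Subset n) x → x ∈ T ∪ ⁅ x ⁆
∈-add⁺ T x = x∈p∪q⁺ (inj₂ (x∈⁅x⁆ x))

∈-add⁻ : ∀ (T : Subset n) → y ∈ T ∪ ⁅ x ⁆ → y ≢ x → y ∈ T
∈-add⁻ T y∈ y≢x with x∈p∪q⁻ T _ y∈
... | inj₁ y∈T = y∈T
... | inj₂ y∈x = contradiction (x∈⁅y⁆⇒x≡y _ y∈x) y≢x

add-⊆ : ∀ {S T : Subset n} → S ⊆ T → x ∈ T → S ∪ ⁅ x ⁆ ⊆ T
add-⊆ {x = x} {S} S⊆T x∈T {y} y∈ with y FinP.≟ x
... | yes refl = x∈T
... | no y≢x   = S⊆T (∈-add⁻ S y∈ y≢x)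

∣add∣ : ∀ (T : Subset n) → x ∉ T → ∣ T ∪ ⁅ x ⁆ ∣ ≡ suc ∣ T ∣
∣add∣ {x = zero}  (inside ∷ T)  x∉ = contradiction here x∉
∣add∣ {x = zero}  (outside ∷ T) x∉ = cong (suc ∘ ∣_∣) (∪-identityʳ T)
∣add∣ {x = suc x} (inside ∷ T)  x∉ = cong suc (∣add∣ T (x∉ ∘ there))
∣add∣ {x = suc x} (outside ∷ T) x∉ = ∣add∣ T (x∉ ∘ there)

add-∩-∈ : ∀ (T : Subset n) → x ∈ B → (T ∪ ⁅ x ⁆) ∩ B ≡ (T ∩ B) ∪ ⁅ x ⁆
add-∩-∈ {x = x} {B} T x∈B = ⊆-antisym to from
  where
  to : (T ∪ ⁅ x ⁆) ∩ B ⊆ (T ∩ B) ∪ ⁅ x ⁆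
  to y∈ with x∈p∩q⁻ _ _ y∈
  ... | y∈T+x , y∈B with x∈p∪q⁻ _ _ y∈T+x
  ...   | inj₁ y∈T = x∈p∪q⁺ (inj₁ (x∈p∩q⁺ (y∈T , y∈B)))
  ...   | inj₂ y∈x = x∈p∪q⁺ (inj₂ y∈x)
  from : (T ∩ B) ∪ ⁅ x ⁆ ⊆ (T ∪ ⁅ x ⁆) ∩ B
  from y∈ with x∈p∪q⁻ _ _ y∈
  ... | inj₁ y∈TB = x∈p∩q⁺ (x∈p∪q⁺ (inj₁ (proj₁ (x∈p∩q⁻ _ _ y∈TB))) , proj₂ (x∈p∩q⁻ T _ y∈TB))
  ... | inj₂ y∈x with refl ← x∈⁅y⁆⇒x≡y _ y∈x = x∈p∩q⁺ (∈-add⁺ T x , x∈B)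

add-∩-∉ : ∀ (T : Subset n) → x ∉ B → (T ∪ ⁅ x ⁆) ∩ B ≡ T ∩ B
add-∩-∉ {x = x} {B} T x∉B = ⊆-antisym to from
  where
  to : (T ∪ ⁅ x ⁆) ∩ B ⊆ T ∩ B
  to y∈ with x∈p∩q⁻ _ _ y∈
  ... | y∈T+x , y∈B = x∈p∩q⁺ (∈-add⁻ T y∈T+x (λ { refl → x∉B y∈B }) , y∈B)
  from : T ∩ B ⊆ (T ∪ ⁅ x ⁆) ∩ B
  from y∈ with x∈p∩q⁻ _ _ y∈
  ... | y∈T , y∈B = x∈p∩q⁺ (x∈p∪q⁺ (inj₁ y∈T) , y∈B)

∣add-∩∣ : ∀ (T : Subset n) → x ∈ B → x ∉ T → ∣ (T ∪ ⁅ x ⁆) ∩ B ∣ ≡ suc ∣ T ∩ B ∣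
∣add-∩∣ T x∈B x∉T = trans (cong ∣_∣ (add-∩-∈ T x∈B)) (∣add∣ (T ∩ _) (x∉T ∘ proj₁ ∘ x∈p∩q⁻ _ _))

∩-mono-∣∣ : ∀ {A A′ B B′ : Subset n} → A ⊆ A′ → B ⊆ B′ → ∣ A ∩ B ∣ ℕ.≤ ∣ A′ ∩ B′ ∣
∩-mono-∣∣ {A = A} A⊆ B⊆ = p⊆q⇒∣p∣≤∣q∣ λ y∈ → x∈p∩q⁺ (A⊆ (proj₁ (x∈p∩q⁻ _ _ y∈)) , B⊆ (proj₂ (x∈p∩q⁻ A _ y∈)))

∣add-∩∣≤ : ∀ (T : Subset n) x B → ∣ (T ∪ ⁅ x ⁆) ∩ B ∣ ℕ.≤ suc ∣ T ∩ B ∣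
∣add-∩∣≤ T x B with x ∈? B | x ∈? T
... | no x∉B  | _      = ℕP.m≤n⇒m≤1+n (ℕP.≤-reflexive (cong ∣_∣ (add-∩-∉ T x∉B)))
... | yes x∈B | no x∉T = ℕP.≤-reflexive (∣add-∩∣ T x∈B x∉T)
... | yes x∈B | yes x∈T = ℕP.m≤n⇒m≤1+n (∩-mono-∣∣ (add-⊆ {S = T} id x∈T) id)

x∈p─q⇒x∉q : ∀ (p q : Subset n) → x ∈ p ─ q → x ∉ q
x∈p─q⇒x∉q (_ ∷ p) (_ ∷ q) (there x∈) (there x∈q) = x∈p─q⇒x∉q p q x∈ x∈q

∣∩∣-split : ∀ (J R B : Subset n) → B ⊆ R → ∣ J ∩ R ∣ ≡ ∣ J ∩ B ∣ ℕ.+ ∣ J ∩ (R ─ B) ∣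
∣∩∣-split [] [] [] _ = refl
∣∩∣-split (outside ∷ J) (r ∷ R) (b ∷ B) B⊆R = ∣∩∣-split J R B (drop-∷-⊆ B⊆R)
∣∩∣-split (inside ∷ J) (outside ∷ R) (inside ∷ B) B⊆R = contradiction (B⊆R here) λ ()
∣∩∣-split (inside ∷ J) (outside ∷ R) (outside ∷ B) B⊆R = ∣∩∣-split J R B (drop-∷-⊆ B⊆R)
∣∩∣-split (inside ∷ J) (inside ∷ R) (inside ∷ B) B⊆R = cong suc (∣∩∣-split J R B (drop-∷-⊆ B⊆R))
∣∩∣-split (inside ∷ J) (inside ∷ R) (outside ∷ B) B⊆R = trans (cong suc (∣∩∣-split J R B (drop-∷-⊆ B⊆R))) (sym (ℕP.+-suc _ _))

-- The witness must lie inside `R` so that `cover-count` can cut it off from `R` as a whole.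
-- Elements common to `I` and `J` need no witness, since they count equally on both sides.
Covered : List (Subset n) → (I J R : Subset n) → Set
Covered Bs I J R = ∀ {y} → y ∈ J → y ∉ I → y ∈ R → ∃ λ B → B ∈ˡ Bs × y ∈ B × B ⊆ R × ∣ J ∩ B ∣ ℕ.≤ ∣ I ∩ B ∣

-- A maximal good member can be split off R, after which the members meeting it are no longer needed.
cover-count : ∀ (Bs : List (Subset n)) → (∀ {A B} → A ∈ˡ Bs → B ∈ˡ Bs → DisjointOrNested A B) →
  ∀ I J R → Covered Bs I J R →
  ∣ J ∩ R ∣ ℕ.≤ ∣ I ∩ R ∣
cover-count [] lam I J R cov = p⊆q⇒∣p∣≤∣q∣ sub
  where
  sub : J ∩ R ⊆ I ∩ R
  sub {y} y∈ with x∈p∩q⁻ _ _ y∈ | y ∈? I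
  ... | y∈J , y∈R | yes y∈I = x∈p∩q⁺ (y∈I , y∈R)
  ... | y∈J , y∈R | no y∉I with () ← proj₁ (proj₂ (cov y∈J y∉I y∈R))
cover-count (A ∷ Bs) lam I J R cov with (A ⊆? R) ×-dec (∣ J ∩ A ∣ ℕ.≤? ∣ I ∩ A ∣)
... | no ¬good = cover-count Bs (λ p q → lam (there p) (there q)) I J R cov′
  where
  cov′ : Covered Bs I J R
  cov′ y∈J y∉I y∈R with cov y∈J y∉I y∈R
  ... | B , here refl , y∈B , B⊆R , le = contradiction ((λ {_} → B⊆R) , le) ¬good
  ... | B , there B∈ , rest = B , B∈ , rest
... | yes (A⊆R , leA) with any? (λ B → (A ⊆? B) ×-dec ((B ⊆? R) ×-dec (∣ J ∩ B ∣ ℕ.≤? ∣ I ∩ B ∣))) Bs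
-- A larger good member serves every element that `A` served, so `A` may be forgotten.
...   | yes sup = cover-count Bs (λ p q → lam (there p) (there q)) I J R cov′
  where
  cov′ : Covered Bs I J R
  cov′ y∈J y∉I y∈R with cov y∈J y∉I y∈R
  ... | B , there B∈ , rest = B , B∈ , rest
  ... | _ , here refl , y∈A , _ with find sup
  ...   | B , B∈ , A⊆B , B⊆R , le = B , B∈ , A⊆B y∈A , (λ {_} → B⊆R) , le
...   | no ¬sup = begin
    ∣ J ∩ R ∣                         ≡⟨ ∣∩∣-split J R A A⊆R ⟩
    ∣ J ∩ A ∣ ℕ.+ ∣ J ∩ (R ─ A) ∣     ≤⟨ ℕP.+-mono-≤ leA (cover-count Bs (λ p q → lam (there p) (there q)) I J (R ─ A) cov′) ⟩
    ∣ I ∩ A ∣ ℕ.+ ∣ I ∩ (R ─ A) ∣     ≡⟨ ∣∩∣-split I R A A⊆R ⟨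
    ∣ I ∩ R ∣                         ∎
  where
  open ℕP.≤-Reasoning
  cov′ : Covered Bs I J (R ─ A)
  cov′ y∈J y∉I y∈R-A with cov y∈J y∉I (p─q⊆p R A y∈R-A)
  ... | _ , here refl , y∈A , _ = contradiction y∈A (x∈p─q⇒x∉q R A y∈R-A)
  -- Only disjointness is possible: a `B` above `A` contradicts the maximality of `A`, and a `B`
  -- inside `A` cannot contain `y`.
  ... | B , there B∈ , y∈B , B⊆R , le with lam (here refl) (there B∈)
  ...   | inj₁ disj = B , B∈ , y∈B , (λ z∈B → x∈p∧x∉q⇒x∈p─q (B⊆R z∈B) λ z∈A → disj (_ , x∈p∩q⁺ (z∈A , z∈B))) , le
  ...   | inj₂ (inj₁ A⊆B) = contradiction (lose B∈ ((λ {_} → A⊆B) , (λ {_} → B⊆R) , le)) ¬sup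
  ...   | inj₂ (inj₂ B⊆A) = contradiction (B⊆A y∈B) (x∈p─q⇒x∉q R A y∈R-A)

-- Spanning, tight members and scans

module Matroid (L : Laminar n) where

  ind? : (T : Subset n) → Dec (Independent L T)
  ind? T = all? (λ c → ∣ T ∩ proj₁ c ∣ ℕ.≤? proj₂ c) (family L)

  ind-⊆ : ∀ {S T} → S ⊆ T → Independent L T → Independent L S
  ind-⊆ S⊆T = All.map (ℕP.≤-trans (∩-mono-∣∣ S⊆T id))

  ind-⊥ : Independent L ⊥
  ind-⊥ = All.tabulate λ {c} _ → subst (ℕ._≤ proj₂ c) (sym (trans (cong ∣_∣ (∩-zeroˡ (proj₁ c))) (∣⊥∣≡0 n))) z≤n

  members : List (Subset n)
  members = map proj₁ (family L)

  laminar-∈ : ∀ {c d} → c ∈ˡ family L → d ∈ˡ family L → DisjointOrNested (proj₁ c) (proj₁ d)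
  laminar-∈ c∈ d∈ = All.lookup (All.lookup (laminar L) c∈) d∈

  laminar-members : ∀ {A B} → A ∈ˡ members → B ∈ˡ members → DisjointOrNested A B
  laminar-members A∈ B∈ with ∈-map⁻ proj₁ A∈ | ∈-map⁻ proj₁ B∈
  ... | _ , c∈ , refl | _ , d∈ , refl = laminar-∈ c∈ d∈

  -- Adding `y` raises only the counts of members containing `y`, each by at most one, so the member
  -- violated afterwards was full before.
  tight : ∀ T {y} → Independent L T → ¬ Independent L (T ∪ ⁅ y ⁆) →
    ∃ λ c → c ∈ˡ family L × y ∈ proj₁ c × proj₂ c ℕ.≤ ∣ T ∩ proj₁ c ∣
  tight T {y} iT dep with find (¬All⇒Any¬ (λ c → ∣ (T ∪ ⁅ y ⁆) ∩ proj₁ c ∣ ℕ.≤? proj₂ c) _ dep)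
  ... | c , c∈ , ¬le with y ∈? proj₁ c
  ...   | yes y∈ = c , c∈ , y∈ , ℕP.≤-pred (ℕP.≤-trans (ℕP.≰⇒> ¬le) (∣add-∩∣≤ T y (proj₁ c)))
  ...   | no y∉ = contradiction (subst (ℕ._≤ proj₂ c) (cong ∣_∣ (sym (add-∩-∉ T y∉))) (All.lookup iT c∈)) ¬le

  -- The set `J` lies in the span of `I`, stated through one-element extensions. In the uses, `I` is
  -- the greedy solution over all elements scanned so far and `J` the one over the sampled elements
  -- among them.
  record Dominates (I J : Subset n) : Set where
    field
      indI  : Independent L I
      indJ  : Independent L J
      spans : ∀ {y} → y ∈ J → y ∉ I → ¬ Independent L (I ∪ ⁅ y ⁆)
  open Dominates

  dominates-⊥ : Dominates ⊥ ⊥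
  dominates-⊥ = record { indI = ind-⊥ ; indJ = ind-⊥ ; spans = λ y∈ → contradiction y∈ ∉⊥ }

  -- Each element of `J` outside `I` lies in a member filled by `I`, where the independence of `J`
  -- bounds its count by the capacity; `cover-count` adds up these local comparisons.
  dominates-∣∣ : ∀ {I J} → Dominates I J → ∣ J ∣ ℕ.≤ ∣ I ∣
  dominates-∣∣ {I} {J} dom = begin
    ∣ J ∣       ≡⟨ cong ∣_∣ (∩-identityʳ J) ⟨
    ∣ J ∩ ⊤ ∣   ≤⟨ cover-count members laminar-members I J ⊤ cov ⟩
    ∣ I ∩ ⊤ ∣   ≡⟨ cong ∣_∣ (∩-identityʳ I) ⟩
    ∣ I ∣       ∎
    where
    open ℕP.≤-Reasoning
    cov : Covered members I J ⊤
    cov y∈J y∉I _ with tight I (indI dom) (spans dom y∈J y∉I)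
    ... | c , c∈ , y∈c , le = proj₁ c , ∈-map⁺ proj₁ c∈ , y∈c , (λ _ → ∈⊤) , ℕP.≤-trans (All.lookup (indJ dom) c∈) le

  -- Fix a member `B` containing `e`. A member filled by `I` that meets `B` cannot contain `B`, for
  -- it would contain `e` and leave no room for it. By laminarity it lies inside `B`, so
  -- `cover-count` gives `J` at most as many elements of `B` as `I`, and `e` fits with `J` because
  -- it fits with `I`.
  dominates-free : ∀ {I J e} → Dominates I J → e ∉ I → Independent L (I ∪ ⁅ e ⁆) → Independent L (J ∪ ⁅ e ⁆)
  dominates-free {I} {J} {e} dom e∉I indIe = All.tabulate ok
    where
    open ℕP.≤-Reasoning
    ok : ∀ {c} → c ∈ˡ family L → ∣ (J ∪ ⁅ e ⁆) ∩ proj₁ c ∣ ℕ.≤ proj₂ c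
    ok {B , μ} c∈ with e ∈? B
    ... | no e∉B = subst (ℕ._≤ μ) (cong ∣_∣ (sym (add-∩-∉ J e∉B))) (All.lookup (indJ dom) c∈)
    ... | yes e∈B = begin
      ∣ (J ∪ ⁅ e ⁆) ∩ B ∣   ≤⟨ ∣add-∩∣≤ J e B ⟩
      suc ∣ J ∩ B ∣         ≤⟨ s≤s (cover-count members laminar-members I J B cov) ⟩
      suc ∣ I ∩ B ∣         ≡⟨ ∣add-∩∣ I e∈B e∉I ⟨
      ∣ (I ∪ ⁅ e ⁆) ∩ B ∣   ≤⟨ All.lookup indIe c∈ ⟩
      μ                     ∎
      where
      cov : Covered members I J B
      cov y∈J y∉I y∈B with tight I (indI dom) (spans dom y∈J y∉I)
      ... | (A , ν) , d∈ , y∈A , le with laminar-∈ d∈ c∈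
      ...   | inj₁ disj = contradiction (_ , x∈p∩q⁺ (y∈A , y∈B)) disj
      ...   | inj₂ (inj₁ A⊆B) = A , ∈-map⁺ proj₁ d∈ , y∈A , A⊆B , ℕP.≤-trans (All.lookup (indJ dom) d∈) le
      ...   | inj₂ (inj₂ B⊆A) = contradiction (ℕP.≤-trans (s≤s le) (ℕP.≤-trans (ℕP.≤-reflexive (sym (∣add-∩∣ I (B⊆A e∈B) e∉I))) (All.lookup indIe d∈))) ℕP.1+n≰n

  scan : Subset n → List (Fin n) → Subset n → Subset n
  scan H []      T = T
  scan H (x ∷ l) T with x ∈? H | ind? (T ∪ ⁅ x ⁆)
  ... | yes _ | yes _ = scan H l (T ∪ ⁅ x ⁆)
  ... | yes _ | no  _ = scan H l T
  ... | no  _ | _     = scan H l T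

  -- An unsampled element that fits is recorded but not put into `T`, so it leaves no trace on later
  -- tests: one tail never blocks another.
  addable : Subset n → List (Fin n) → Subset n → Subset n
  addable H []      T = ⊥
  addable H (x ∷ l) T with x ∈? H | ind? (T ∪ ⁅ x ⁆)
  ... | yes _ | yes _ = addable H l (T ∪ ⁅ x ⁆)
  ... | yes _ | no  _ = addable H l T
  ... | no  _ | yes _ = addable H l T ∪ ⁅ x ⁆
  ... | no  _ | no  _ = addable H l T

  scan-⊇ : ∀ H l T → T ⊆ scan H l T
  scan-⊇ H []      T y∈ = y∈
  scan-⊇ H (x ∷ l) T y∈ with x ∈? H | ind? (T ∪ ⁅ x ⁆)
  ... | yes _ | yes _ = scan-⊇ H l _ (x∈p∪q⁺ (inj₁ y∈))
  ... | yes _ | no  _ = scan-⊇ H l T y∈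
  ... | no  _ | _     = scan-⊇ H l T y∈

  scan-∉ : ∀ H l T → x ∉ T → x ∉ H → x ∉ scan H l T
  scan-∉ H [] T x∉T x∉H = x∉T
  scan-∉ H (y ∷ l) T x∉T x∉H with y ∈? H | ind? (T ∪ ⁅ y ⁆)
  ... | yes y∈ | yes _ = scan-∉ H l _ (λ x∈ → x∉T (∈-add⁻ T x∈ λ { refl → x∉H y∈ })) x∉H
  ... | yes _ | no  _ = scan-∉ H l T x∉T x∉H
  ... | no  _ | _     = scan-∉ H l T x∉T x∉H

  -- The scans for `H` and `H ∪ ⁅ x ⁆` can part only where `x` itself is scanned and fits, and that
  -- occurrence would put `x` into `addable`.
  scan-unaddable : ∀ H l T → x ∉ H → x ∉ addable H l T → scan (H ∪ ⁅ x ⁆) l T ≡ scan H l T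
  scan-unaddable H [] T x∉H x∉A = refl
  scan-unaddable {x = x} H (y ∷ l) T x∉H x∉A with y ∈? H | y ∈? (H ∪ ⁅ x ⁆) | ind? (T ∪ ⁅ y ⁆)
  ... | yes y∈ | yes _  | yes _ = scan-unaddable H l _ x∉H x∉A
  ... | yes y∈ | yes _  | no _  = scan-unaddable H l T x∉H x∉A
  ... | yes y∈ | no y∉  | _     = contradiction (x∈p∪q⁺ (inj₁ y∈)) y∉
  ... | no y∉  | no _   | yes _ = scan-unaddable H l T x∉H (x∉A ∘ x∈p∪q⁺ ∘ inj₁)
  ... | no y∉  | no _   | no _  = scan-unaddable H l T x∉H x∉A
  ... | no y∉  | yes _  | no _  = scan-unaddable H l T x∉H x∉A
  ... | no y∉  | yes y∈ | yes _ with y FinP.≟ x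
  ...   | yes refl = contradiction (∈-add⁺ _ x) x∉A
  ...   | no y≢x   = contradiction (∈-add⁻ H y∈ y≢x) y∉

  -- The two scans agree up to the first place where `x` fits; there the larger sample takes it, and
  -- a scan never removes an element.
  addable-scan : ∀ H l T → x ∉ H → x ∈ addable H l T → x ∈ scan (H ∪ ⁅ x ⁆) l T
  addable-scan H [] T x∉H x∈ = contradiction x∈ ∉⊥
  addable-scan {x = x} H (y ∷ l) T x∉H x∈ with y ∈? H | y ∈? (H ∪ ⁅ x ⁆) | ind? (T ∪ ⁅ y ⁆)
  ... | yes y∈ | yes _  | yes _ = addable-scan H l _ x∉H x∈
  ... | yes y∈ | yes _  | no _  = addable-scan H l T x∉H x∈
  ... | yes y∈ | no y∉  | _     = contradiction (x∈p∪q⁺ (inj₁ y∈)) y∉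
  ... | no y∉  | no y∉′ | yes _ = addable-scan H l T x∉H (∈-add⁻ _ x∈ λ { refl → y∉′ (∈-add⁺ H x) })
  ... | no y∉  | no _   | no _  = addable-scan H l T x∉H x∈
  ... | no y∉  | yes _  | no _  = addable-scan H l T x∉H x∈
  ... | no y∉  | yes y∈ | yes _ with y FinP.≟ x
  ...   | yes refl = scan-⊇ (H ∪ ⁅ x ⁆) l _ (∈-add⁺ T x)
  ...   | no y≢x   = contradiction (∈-add⁻ H y∈ y≢x) y∉

  -- Being unsampled, `e` never enters `T`, so deleting it leaves the tests of all other elements
  -- unchanged. This detaches the competitors of `e` from its coin.
  addable-drop : ∀ H l₁ l₂ T {e} → e ∉ H → x ∈ addable H (l₁ ++ e ∷ l₂) T → x ≢ e → x ∈ addable H (l₁ ++ l₂) T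
  addable-drop H [] l₂ T {e} e∉H x∈ x≢e with e ∈? H | ind? (T ∪ ⁅ e ⁆)
  ... | yes e∈ | _ = contradiction e∈ e∉H
  ... | no _ | yes _ = ∈-add⁻ _ x∈ x≢e
  ... | no _ | no _ = x∈
  addable-drop H (y ∷ l₁) l₂ T e∉H x∈ x≢e with y ∈? H | ind? (T ∪ ⁅ y ⁆)
  ... | yes _ | yes _ = addable-drop H l₁ l₂ _ e∉H x∈ x≢e
  ... | yes _ | no  _ = addable-drop H l₁ l₂ T e∉H x∈ x≢e
  ... | no  _ | no  _ = addable-drop H l₁ l₂ T e∉H x∈ x≢e
  ... | no  _ | yes _ with x∈p∪q⁻ _ _ x∈
  ...   | inj₁ x∈A = x∈p∪q⁺ (inj₁ (addable-drop H l₁ l₂ T e∉H x∈A x≢e))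
  ...   | inj₂ x∈y = x∈p∪q⁺ (inj₂ x∈y)

  addable-cong : ∀ {H H′} l T → (∀ {y} → y ∈ˡ l → (y ∈ H → y ∈ H′) × (y ∈ H′ → y ∈ H)) → addable H l T ≡ addable H′ l T
  addable-cong [] T eq = refl
  addable-cong {H} {H′} (x ∷ l) T eq with x ∈? H | x ∈? H′ | ind? (T ∪ ⁅ x ⁆)
  ... | yes _ | yes _ | yes _ = addable-cong l _ (eq ∘ there)
  ... | yes _ | yes _ | no  _ = addable-cong l T (eq ∘ there)
  ... | no  _ | no  _ | yes _ = cong (_∪ ⁅ x ⁆) (addable-cong l T (eq ∘ there))
  ... | no  _ | no  _ | no  _ = addable-cong l T (eq ∘ there)
  ... | yes x∈ | no x∉ | _ = contradiction (proj₁ (eq (here refl)) x∈) x∉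
  ... | no x∉ | yes x∈ | _ = contradiction (proj₂ (eq (here refl)) x∈) x∉

  ind-dropˡ : ∀ I x y → Independent L ((I ∪ ⁅ x ⁆) ∪ ⁅ y ⁆) → Independent L (I ∪ ⁅ y ⁆)
  ind-dropˡ I x y = ind-⊆ sub
    where
    sub : I ∪ ⁅ y ⁆ ⊆ (I ∪ ⁅ x ⁆) ∪ ⁅ y ⁆
    sub z∈ with x∈p∪q⁻ I _ z∈
    ... | inj₁ p = x∈p∪q⁺ (inj₁ (p⊆p∪q _ p))
    ... | inj₂ p = x∈p∪q⁺ (inj₂ p)

  dom-add : ∀ {I J} x → Dominates I J → Independent L (I ∪ ⁅ x ⁆) → Independent L (J ∪ ⁅ x ⁆) → Dominates (I ∪ ⁅ x ⁆) (J ∪ ⁅ x ⁆)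
  dom-add {I} {J} x dom iI iJ = record { indI = iI ; indJ = iJ ; spans = sp }
    where
    sp : ∀ {y} → y ∈ J ∪ ⁅ x ⁆ → y ∉ I ∪ ⁅ x ⁆ → ¬ Independent L ((I ∪ ⁅ x ⁆) ∪ ⁅ y ⁆)
    sp {y} y∈ y∉ i with y FinP.≟ x
    ... | yes refl = y∉ (∈-add⁺ I x)
    ... | no y≢x = spans dom (∈-add⁻ J y∈ y≢x) (y∉ ∘ p⊆p∪q _) (ind-dropˡ I x y i)

  dom-addˡ : ∀ {I J} x → Dominates I J → Independent L (I ∪ ⁅ x ⁆) → Dominates (I ∪ ⁅ x ⁆) J
  dom-addˡ {I} {J} x dom iI = record { indI = iI ; indJ = indJ dom ; spans = sp }
    where
    sp : ∀ {y} → y ∈ J → y ∉ I ∪ ⁅ x ⁆ → ¬ Independent L ((I ∪ ⁅ x ⁆) ∪ ⁅ y ⁆)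
    sp {y} y∈ y∉ i = spans dom y∈ (y∉ ∘ p⊆p∪q _) (ind-dropˡ I x y i)

  dom-addʳ : ∀ {I J} x → Dominates I J → ¬ Independent L (I ∪ ⁅ x ⁆) → Independent L (J ∪ ⁅ x ⁆) → Dominates I (J ∪ ⁅ x ⁆)
  dom-addʳ {I} {J} x dom dep iJ = record { indI = indI dom ; indJ = iJ ; spans = sp }
    where
    sp : ∀ {y} → y ∈ J ∪ ⁅ x ⁆ → y ∉ I → ¬ Independent L (I ∪ ⁅ y ⁆)
    sp {y} y∈ y∉ with y FinP.≟ x
    ... | yes refl = dep
    ... | no y≢x = spans dom (∈-add⁻ J y∈ y≢x) y∉

  -- An element of the full greedy solution is spanned by no subset of its predecessors.
  optimal-addable : ∀ H l {I J e} → Dominates I J → e ∉ I → e ∉ H → e ∈ scan ⊤ l I → e ∈ addable H l J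
  optimal-addable H [] dom e∉I e∉H e∈ = contradiction e∈ e∉I
  optimal-addable H (x ∷ l) {I} {J} {e} dom e∉I e∉H e∈ with x ∈? ⊤ {n} | ind? (I ∪ ⁅ x ⁆) | x ∈? H | ind? (J ∪ ⁅ x ⁆)
  ... | no x∉ | _ | _ | _ = contradiction ∈⊤ x∉
  ... | yes _ | no dep | yes _ | yes iJ = optimal-addable H l (dom-addʳ x dom dep iJ) e∉I e∉H e∈
  ... | yes _ | no dep | yes _ | no _ = optimal-addable H l dom e∉I e∉H e∈
  ... | yes _ | no dep | no _ | yes _ = x∈p∪q⁺ (inj₁ (optimal-addable H l dom e∉I e∉H e∈))
  ... | yes _ | no dep | no _ | no _ = optimal-addable H l dom e∉I e∉H e∈
  ... | yes _ | yes iI | yes x∈H | yes iJ = optimal-addable H l (dom-add x dom iI iJ) (λ e∈I → e∉I (∈-add⁻ I e∈I λ { refl → e∉H x∈H })) e∉H e∈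
  ... | yes _ | yes iI | yes x∈H | no _ = optimal-addable H l (dom-addˡ x dom iI) (λ e∈I → e∉I (∈-add⁻ I e∈I λ { refl → e∉H x∈H })) e∉H e∈
  ... | yes _ | yes iI | no _ | iJ? with e FinP.≟ x | iJ?
  ...   | yes refl | yes _  = ∈-add⁺ _ x
  -- `e` fits the full solution `I`, hence also the sampled solution `J` that `I` dominates.
  ...   | yes refl | no dep = contradiction (dominates-free dom e∉I iI) dep
  ...   | no e≢x   | yes _  = x∈p∪q⁺ (inj₁ (optimal-addable H l (dom-addˡ x dom iI) (λ e∈I → e∉I (∈-add⁻ I e∈I e≢x)) e∉H e∈))
  ...   | no e≢x   | no _   = optimal-addable H l (dom-addˡ x dom iI) (λ e∈I → e∉I (∈-add⁻ I e∈I e≢x)) e∉H e∈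

  -- Each partial solution stays within `T`, so no element of `T` is ever refused. An arbitrary
  -- independent set thus becomes a scan, with itself as the sample, and can be compared with the
  -- greedy optimum.
  scan-⊇-ind : ∀ {T} → Independent L T → ∀ l S → S ⊆ T → (∀ {y} → y ∈ T → y ∈ S ⊎ y ∈ˡ l) → T ⊆ scan T l S
  scan-⊇-ind iT [] S S⊆T cov y∈ with cov y∈
  ... | inj₁ p = p
  scan-⊇-ind {T} iT (x ∷ l) S S⊆T cov y∈ with x ∈? T | ind? (S ∪ ⁅ x ⁆)
  ... | yes x∈ | no dep = contradiction (ind-⊆ (add-⊆ S⊆T x∈) iT) dep
  ... | yes x∈ | yes _ = scan-⊇-ind iT l _ (add-⊆ S⊆T x∈) cov′ y∈
    where
    cov′ : ∀ {y} → y ∈ T → y ∈ S ∪ ⁅ x ⁆ ⊎ y ∈ˡ l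
    cov′ z∈ with cov z∈
    ... | inj₁ p = inj₁ (p⊆p∪q _ p)
    ... | inj₂ (here refl) = inj₁ (∈-add⁺ S x)
    ... | inj₂ (there p) = inj₂ p
  ... | no x∉ | _ = scan-⊇-ind iT l S S⊆T cov′ y∈
    where
    cov′ : ∀ {y} → y ∈ T → y ∈ S ⊎ y ∈ˡ l
    cov′ z∈ with cov z∈
    ... | inj₁ p = inj₁ p
    ... | inj₂ (here refl) = contradiction z∈ x∉
    ... | inj₂ (there p) = inj₂ p

  scan-ind : ∀ H l {T} → Independent L T → Independent L (scan H l T)
  scan-ind H []      i = i
  scan-ind H (x ∷ l) {T} i with x ∈? H | ind? (T ∪ ⁅ x ⁆)
  ... | yes _ | yes i′ = scan-ind H l i′
  ... | yes _ | no  _  = scan-ind H l i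
  ... | no  _ | _      = scan-ind H l i

-- The greedy algorithm

module _ {P Q : A → Set} (P? : Decidable P) (Q? : Decidable Q) where

  filter-filter : ∀ xs → filter P? (filter Q? xs) ≡ filter (λ x → Q? x ×-dec P? x) xs
  filter-filter [] = refl
  filter-filter (x ∷ xs) with Q? x
  ... | no _ = filter-filter xs
  ... | yes _ with P? x
  ...   | yes _ = cong (x ∷_) (filter-filter xs)
  ...   | no _  = filter-filter xs

  filter-absorb : (∀ {x} → P x → Q x) → ∀ xs → filter P? (filter Q? xs) ≡ filter P? xs
  filter-absorb P⊆Q [] = refl
  filter-absorb P⊆Q (x ∷ xs) with Q? x
  ... | yes _ with P? x
  ...   | yes _ = cong (x ∷_) (filter-absorb P⊆Q xs)
  ...   | no _  = filter-absorb P⊆Q xs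
  filter-absorb P⊆Q (x ∷ xs) | no ¬q with P? x
  ... | yes p = contradiction (P⊆Q p) ¬q
  ... | no _  = filter-absorb P⊆Q xs

-- Rational arithmetic and finite sums

*-monoˡ : ∀ {a b} c → 0ℚ ≤ c → a ≤ b → c * a ≤ c * b
*-monoˡ c 0≤c = ℚP.*-monoˡ-≤-nonNeg c {{nonNegative 0≤c}}

*-monoʳ : ∀ {a b} c → 0ℚ ≤ c → a ≤ b → a * c ≤ b * c
*-monoʳ c 0≤c = ℚP.*-monoʳ-≤-nonNeg c {{nonNegative 0≤c}}

a≤b⇒0≤b-a : ∀ {a b} → a ≤ b → 0ℚ ≤ b - a
a≤b⇒0≤b-a {a} {b} a≤b = subst (_≤ b - a) (ℚP.+-inverseʳ a) (ℚP.+-monoˡ-≤ (- a) a≤b)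

-- The gcd in the normalisation of `+ k / 1` does not compute for a variable `k`, so the identity is
-- checked on unnormalised fractions.
fromℕℚ-suc : ∀ k → fromℕℚ (suc k) ≡ 1ℚ + fromℕℚ k
fromℕℚ-suc k = ℚP.toℚᵘ-injective (begin
  toℚᵘ (fromℕℚ (suc k))            ≈⟨ ℚP.toℚᵘ-fromℚᵘ (mkℚᵘ (+ suc k) 0) ⟩
  mkℚᵘ (+ suc k) 0                 ≈⟨ *≡* (cong (λ z → (+ 1 ℤ.+ z) ℤ.* + 1) (sym (ℤP.*-identityʳ (+ k)))) ⟩
  mkℚᵘ (+ 1) 0 ℚᵘ.+ mkℚᵘ (+ k) 0   ≈⟨ ℚᵘP.+-congʳ (mkℚᵘ (+ 1) 0) (ℚP.toℚᵘ-fromℚᵘ (mkℚᵘ (+ k) 0)) ⟨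
  toℚᵘ 1ℚ ℚᵘ.+ toℚᵘ (fromℕℚ k)     ≈⟨ ℚP.toℚᵘ-homo-+ 1ℚ (fromℕℚ k) ⟨
  toℚᵘ (1ℚ + fromℕℚ k)             ∎)
  where
  open ℚᵘP.≃-Reasoning

0≤* : ∀ {a b} → 0ℚ ≤ a → 0ℚ ≤ b → 0ℚ ≤ a * b
0≤* {a} {b} 0≤a 0≤b = subst (_≤ a * b) (ℚP.*-zeroʳ a) (*-monoˡ a 0≤a 0≤b)

0≤1 : 0ℚ ≤ 1ℚ
0≤1 = from-yes (0ℚ ℚP.≤? 1ℚ)

0≤^ : ∀ {r} → 0ℚ ≤ r → ∀ k → 0ℚ ≤ r ^ℚ k
0≤^ 0≤r zero    = 0≤1
0≤^ 0≤r (suc k) = 0≤* 0≤r (0≤^ 0≤r k)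

0≤fromℕℚ : ∀ k → 0ℚ ≤ fromℕℚ k
0≤fromℕℚ zero = ℚP.≤-refl
0≤fromℕℚ (suc k) = subst (0ℚ ≤_) (sym (fromℕℚ-suc k)) (ℚP.+-mono-≤ 0≤1 (0≤fromℕℚ k))

fromℕℚ-mono : ∀ {j k} → j ℕ.≤ k → fromℕℚ j ≤ fromℕℚ k
fromℕℚ-mono {k = k} z≤n = 0≤fromℕℚ k
fromℕℚ-mono {suc j} {suc k} (s≤s j≤k) rewrite fromℕℚ-suc j | fromℕℚ-suc k = ℚP.+-monoʳ-≤ 1ℚ (fromℕℚ-mono j≤k)

∑ : List A → (A → ℚ) → ℚ
∑ []      g = 0ℚ
∑ (x ∷ l) g = g x + ∑ l g

foldl-∑ : ∀ (g : A → ℚ) a l → foldl (λ s x → s + g x) a l ≡ a + ∑ l g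
foldl-∑ g a []      = sym (ℚP.+-identityʳ a)
foldl-∑ g a (x ∷ l) = trans (foldl-∑ g (a + g x) l) (ℚP.+-assoc a (g x) (∑ l g))

∑-cong : ∀ {g h : A → ℚ} l → (∀ {x} → x ∈ˡ l → g x ≡ h x) → ∑ l g ≡ ∑ l h
∑-cong []      eq = refl
∑-cong (x ∷ l) eq = cong₂ _+_ (eq (here refl)) (∑-cong l (eq ∘ there))

∑-mono : ∀ {g h : A → ℚ} l → (∀ {x} → x ∈ˡ l → g x ≤ h x) → ∑ l g ≤ ∑ l h
∑-mono []      le = ℚP.≤-refl
∑-mono (x ∷ l) le = ℚP.+-mono-≤ (le (here refl)) (∑-mono l (le ∘ there))

∑-zero : ∀ (l : List A) → ∑ l (λ _ → 0ℚ) ≡ 0ℚ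
∑-zero []      = refl
∑-zero (_ ∷ l) = trans (ℚP.+-identityˡ _) (∑-zero l)

0≤∑ : ∀ (l : List A) {g} → (∀ x → 0ℚ ≤ g x) → 0ℚ ≤ ∑ l g
0≤∑ l {g} 0≤g = subst (_≤ ∑ l g) (∑-zero l) (∑-mono l λ {x} _ → 0≤g x)

-- Weights and the order in which greedy takes elements

module Weight (w : Weights n) where

  val : Subset n → Fin n → ℚ
  val T e = if does (e ∈? T) then w e else 0ℚ

  f-∑ : ∀ T → f w T ≡ ∑ (allFin n) (val T)
  f-∑ T = trans (foldl-∑ (val T) 0ℚ (allFin n)) (ℚP.+-identityˡ _)

  val-∈ : ∀ {T e} → e ∈ T → val T e ≡ w e
  val-∈ {T} {e} e∈ rewrite dec-true (e ∈? T) e∈ = refl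

  val-∉ : ∀ {T e} → e ∉ T → val T e ≡ 0ℚ
  val-∉ {T} {e} e∉ rewrite dec-false (e ∈? T) e∉ = refl

  0≤val : (∀ e → 0ℚ ≤ w e) → ∀ T e → 0ℚ ≤ val T e
  0≤val w≥0 T e with e ∈? T
  ... | yes _ = w≥0 e
  ... | no _  = ℚP.≤-refl

  val-add : ∀ {T e x} → e ≢ x → val (T ∪ ⁅ x ⁆) e ≡ val T e
  val-add {T} {e} {x} e≢x with e ∈? T
  ... | yes e∈ = val-∈ {T ∪ ⁅ x ⁆} (p⊆p∪q _ e∈)
  ... | no e∉ = val-∉ {T ∪ ⁅ x ⁆} λ e∈ → e∉ (∈-add⁻ T e∈ e≢x)

  ∑-val-add : ∀ {T x} l → Unique l → x ∈ˡ l → x ∉ T → ∑ l (val (T ∪ ⁅ x ⁆)) ≡ ∑ l (val T) + w x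
  ∑-val-add {T} {x} (x ∷ l) (x≢l ∷ _) (here refl) x∉ = begin
    val (T ∪ ⁅ x ⁆) x + ∑ l (val (T ∪ ⁅ x ⁆))  ≡⟨ cong₂ _+_ (val-∈ {T ∪ ⁅ x ⁆} (∈-add⁺ T x)) (∑-cong l λ y∈ → val-add {T} λ { refl → All.lookup x≢l y∈ refl }) ⟩
    w x + ∑ l (val T)                          ≡⟨ ℚP.+-comm (w x) _ ⟩
    ∑ l (val T) + w x                          ≡⟨ cong (_+ w x) (ℚP.+-identityˡ (∑ l (val T))) ⟨
    0ℚ + ∑ l (val T) + w x                     ≡⟨ cong (λ v → v + ∑ l (val T) + w x) (val-∉ {T} x∉) ⟨
    val T x + ∑ l (val T) + w x                ∎
    where open ≡-Reasoning
  ∑-val-add {T} {x} (y ∷ l) (y≢l ∷ u) (there x∈) x∉ =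
    trans (cong₂ _+_ (val-add {T} (All.lookup y≢l x∈)) (∑-val-add {T} l u x∈ x∉))
          (sym (ℚP.+-assoc (val T y) _ _))

  f-add : ∀ {T x} → x ∉ T → f w (T ∪ ⁅ x ⁆) ≡ f w T + w x
  f-add {T} {x} x∉ = trans (f-∑ (T ∪ ⁅ x ⁆)) (trans (∑-val-add {T} (allFin n) (allFin⁺ n) (∈-allFin x) x∉) (cong (_+ w x) (sym (f-∑ T))))

  f-mono : (∀ e → 0ℚ ≤ w e) → ∀ {S T} → S ⊆ T → f w S ≤ f w T
  f-mono w≥0 {S} {T} S⊆T rewrite f-∑ S | f-∑ T = ∑-mono (allFin n) λ {x} _ → le x
    where
    le : ∀ x → val S x ≤ val T x
    le x with x ∈? S | x ∈? T
    ... | yes _ | yes _ = ℚP.≤-refl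
    ... | yes x∈ | no x∉ = contradiction (S⊆T x∈) x∉
    ... | no _ | yes _ = w≥0 x
    ... | no _ | no _ = ℚP.≤-refl

  best-∷-nothing : ∀ {x} xs → best w xs ≡ nothing → best w (x ∷ xs) ≡ just x
  best-∷-nothing xs eq rewrite eq = refl

  best-∷-≤ : ∀ {x y} xs → best w xs ≡ just y → w y ≤ w x → best w (x ∷ xs) ≡ just x
  best-∷-≤ {x} {y} xs eq y≤x rewrite eq =
    cong (λ b → if b then just x else just y) (dec-true (w y ℚP.≤? w x) y≤x)

  best-∷-≰ : ∀ {x y} xs → best w xs ≡ just y → ¬ (w y ≤ w x) → best w (x ∷ xs) ≡ just y
  best-∷-≰ {x} {y} xs eq y≰x rewrite eq =
    cong (λ b → if b then just x else just y) (dec-false (w y ℚP.≤? w x) y≰x)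

  data Best (x : Fin n) (xs : List (Fin n)) : Fin n → Set where
    single : best w xs ≡ nothing → Best x xs x
    first  : ∀ {y} → best w xs ≡ just y → w y ≤ w x → Best x xs x
    later  : ∀ {y} → best w xs ≡ just y → ¬ (w y ≤ w x) → Best x xs y

  best-∷⁻ : ∀ {x e} xs → best w (x ∷ xs) ≡ just e → Best x xs e
  best-∷⁻ {x} {e} xs eq = split (best w xs) refl
    where
    result : ∀ {z} → best w (x ∷ xs) ≡ just z → Best x xs z → Best x xs e
    result eq′ = subst (Best x xs) (just-injective (trans (sym eq′) eq))
    split : ∀ m → best w xs ≡ m → Best x xs e
    split nothing  eq′ = result (best-∷-nothing xs eq′) (single eq′)
    split (just y) eq′ with w y ℚP.≤? w x
    ... | yes y≤x = result (best-∷-≤ xs eq′ y≤x) (first eq′ y≤x)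
    ... | no y≰x  = result (best-∷-≰ xs eq′ y≰x) (later eq′ y≰x)

  best-nothing : ∀ xs → best w xs ≡ nothing → xs ≡ []
  best-nothing [] eq = refl
  best-nothing (x ∷ xs) eq = absurd (best w xs) refl
    where
    absurd : ∀ m → best w xs ≡ m → x ∷ xs ≡ []
    absurd nothing eq′ with () ← trans (sym eq) (best-∷-nothing xs eq′)
    absurd (just y) eq′ with w y ℚP.≤? w x
    ... | yes y≤x with () ← trans (sym eq) (best-∷-≤ xs eq′ y≤x)
    ... | no y≰x with () ← trans (sym eq) (best-∷-≰ xs eq′ y≰x)

  best-∈ : ∀ {xs e} → best w xs ≡ just e → e ∈ˡ xs
  best-∈ {x ∷ xs} eq with best-∷⁻ xs eq
  ... | single _    = here refl
  ... | first _ _   = here refl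
  ... | later eq′ _ = there (best-∈ eq′)

  best-max : ∀ {xs e} → best w xs ≡ just e → ∀ {y} → y ∈ˡ xs → w y ≤ w e
  best-max {x ∷ xs} eq y∈ with best-∷⁻ xs eq | y∈
  ... | single _      | here refl = ℚP.≤-refl
  ... | single eq′    | there y∈′ with () ← subst (_ ∈ˡ_) (best-nothing xs eq′) y∈′
  ... | first _ _     | here refl = ℚP.≤-refl
  ... | first eq′ z≤x | there y∈′ = ℚP.≤-trans (best-max eq′ y∈′) z≤x
  ... | later _ z≰x   | here refl = ℚP.<⇒≤ (ℚP.≰⇒> z≰x)
  ... | later eq′ _   | there y∈′ = best-max eq′ y∈′

  -- Removing other candidates produces no heavier rival, and ties are decided by list position,
  -- which filtering preserves. Hence one order, sorted in advance, serves every greedy run.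
  best-filter : ∀ {P : Fin n → Set} (P? : Decidable P) {e} xs → best w xs ≡ just e → P e → best w (filter P? xs) ≡ just e
  best-filter P? {e} (x ∷ xs) eq Pe with best-∷⁻ xs eq
  ... | single eq′ rewrite best-nothing xs eq′ | dec-true (P? x) Pe = refl
  ... | later eq′ z≰x with P? x
  ...   | no _  = best-filter P? xs eq′ Pe
  ...   | yes _ = best-∷-≰ (filter P? xs) (best-filter P? xs eq′ Pe) z≰x
  best-filter P? {e} (x ∷ xs) eq Pe | first {z} eq′ z≤x with P? x
  ... | no ¬Px = contradiction Pe ¬Px
  ... | yes _  = split (best w (filter P? xs)) refl
    where
    split : ∀ m → best w (filter P? xs) ≡ m → best w (x ∷ filter P? xs) ≡ just x
    split nothing  eq″ = best-∷-nothing (filter P? xs) eq″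
    split (just v) eq″ = best-∷-≤ (filter P? xs) eq″
      (ℚP.≤-trans (best-max eq′ (proj₁ (∈-filter⁻ P? {xs = xs} (best-∈ eq″)))) z≤x)

  infixl 6 _∖_
  _∖_ : List (Fin n) → Fin n → List (Fin n)
  xs ∖ e = filter (λ y → ¬? (y FinP.≟ e)) xs

  ∖-↭ : ∀ {xs e} → Unique xs → e ∈ˡ xs → xs ↭ e ∷ xs ∖ e
  ∖-↭ {x ∷ xs} {e} (x≢ ∷ u) e∈ with x FinP.≟ e
  ... | yes refl = prep x (Perm.↭-reflexive (sym (filter-all _ (All.map (λ x≢y y≡x → x≢y (sym y≡x)) x≢))))
  ∖-↭ {x ∷ xs} {e} (x≢ ∷ u) (here refl) | no x≢e = contradiction refl x≢e
  ∖-↭ {x ∷ xs} {e} (x≢ ∷ u) (there e∈) | no x≢e = ↭-trans (prep x (∖-↭ u e∈)) (swap x e Perm.refl)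

  -- Decreasing weight, with ties broken as `best` does.
  data Sorted : List (Fin n) → List (Fin n) → Set where
    []  : Sorted [] []
    _∷_ : ∀ {xs e l} → best w xs ≡ just e → Sorted (xs ∖ e) l → Sorted xs (e ∷ l)

  sort : ∀ k xs → Unique xs → length xs ≡ k → ∃ (Sorted xs)
  sort k [] u eq = [] , []
  sort (suc k) xs@(_ ∷ _) u eq = split (best w xs) refl
    where
    split : ∀ m → best w xs ≡ m → ∃ (Sorted xs)
    split nothing  beq with () ← best-nothing xs beq
    split (just e) beq with sort k (xs ∖ e) (filter⁺ (λ y → ¬? (y FinP.≟ e)) u) (ℕP.suc-injective (trans (sym (↭-length (∖-↭ u (best-∈ beq)))) eq))
    ... | l , s = e ∷ l , beq ∷ s

  sorted-↭ : ∀ {xs l} → Unique xs → Sorted xs l → xs ↭ l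
  sorted-↭ u [] = Perm.refl
  sorted-↭ u (_∷_ {e = e} beq s) = ↭-trans (∖-↭ u (best-∈ beq)) (prep _ (sorted-↭ (filter⁺ (λ y → ¬? (y FinP.≟ e)) u) s))

  private
    sorted-allFin = sort n (allFin n) (allFin⁺ n) (length-tabulate id)

  order : List (Fin n)
  order = proj₁ sorted-allFin

  order-sorted : Sorted (allFin n) order
  order-sorted = proj₂ sorted-allFin

  order-↭ : allFin n ↭ order
  order-↭ = sorted-↭ (allFin⁺ n) order-sorted

  -- GREEDY as a scan, and its optimality

  module _ (L : Laminar n) where
    open Matroid L

    module _ (X : Subset n) where

      Candidate : Subset n → Fin n → Set
      Candidate T e = (e ∈ X × ¬ (e ∈ T)) × independent? L (T ∪ ⁅ e ⁆) ≡ true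

      candidate? : ∀ T → Decidable (Candidate T)
      candidate? T e = ((e ∈? X) ×-dec (¬? (e ∈? T))) ×-dec (independent? L (T ∪ ⁅ e ⁆) Bool.≟ true)

      independent : ∀ T → independent? L T ≡ true → Independent L T
      independent T eq with ind? T
      ... | yes i = i

      greedyLoop-nothing : ∀ k T → filter (candidate? T) (allFin n) ≡ [] → greedyLoop k L w X T ≡ T
      greedyLoop-nothing zero T eq = refl
      greedyLoop-nothing (suc k) T eq
        rewrite filter-filter (λ e → independent? L (T ∪ ⁅ e ⁆) Bool.≟ true) (λ e → (e ∈? X) ×-dec (¬? (e ∈? T))) (allFin n)
              | eq = refl

      greedyLoop-just : ∀ k T {e} → best w (filter (candidate? T) (allFin n)) ≡ just e →
        greedyLoop (suc k) L w X T ≡ greedyLoop k L w X (T ∪ ⁅ e ⁆)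
      greedyLoop-just k T eq
        rewrite filter-filter (λ e → independent? L (T ∪ ⁅ e ⁆) Bool.≟ true) (λ e → (e ∈? X) ×-dec (¬? (e ∈? T))) (allFin n)
              | eq = refl

      -- The last hypothesis is the invariant: an element already passed is in `T`, outside `X`, or
      -- dependent on `T`, which is permanent while `T` grows, so it is never a candidate again.
      -- Equality as lists keeps the tie-breaking. Fuel is spent only on additions, so the length of
      -- the remaining list suffices.
      greedyLoop-scan : ∀ k T {xs l} → Sorted xs l → length l ℕ.≤ k → (∀ {y} → y ∈ˡ xs → y ∉ T) →
        filter (candidate? T) (allFin n) ≡ filter (candidate? T) xs →
        greedyLoop k L w X T ≡ scan X l T
      greedyLoop-scan k T [] _ _ inv = greedyLoop-nothing k T inv
      greedyLoop-scan (suc k) T {xs} {e ∷ l} (beq ∷ s) (s≤s len) fresh inv with e ∈? X | ind? (T ∪ ⁅ e ⁆)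
      ... | yes e∈X | yes i = trans (greedyLoop-just k T bestT)
          (greedyLoop-scan k (T ∪ ⁅ e ⁆) s len
            (λ y∈ y∈T → fresh (proj₁ (∈-filter⁻ _ {xs = xs} y∈)) (∈-add⁻ T y∈T (proj₂ (∈-filter⁻ (λ y → ¬? (y FinP.≟ e)) {xs = xs} y∈))))
            inv′)
        where
        bestT : best w (filter (candidate? T) (allFin n)) ≡ just e
        bestT rewrite inv = best-filter (candidate? T) xs beq ((e∈X , fresh (best-∈ beq)) , dec-true (ind? (T ∪ ⁅ e ⁆)) i)
        weaken : ∀ {y} → Candidate (T ∪ ⁅ e ⁆) y → Candidate T y
        weaken {y} ((y∈X , y∉) , i′) = (y∈X , y∉ ∘ p⊆p∪q _) , dec-true (ind? (T ∪ ⁅ y ⁆)) (ind-dropˡ T e y (independent ((T ∪ ⁅ e ⁆) ∪ ⁅ y ⁆) i′))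
        open ≡-Reasoning
        C′ = candidate? (T ∪ ⁅ e ⁆)
        inv′ : filter C′ (allFin n) ≡ filter C′ (xs ∖ e)
        inv′ = begin
          filter C′ (allFin n)                          ≡⟨ filter-absorb C′ (candidate? T) weaken (allFin n) ⟨
          filter C′ (filter (candidate? T) (allFin n))  ≡⟨ cong (filter C′) inv ⟩
          filter C′ (filter (candidate? T) xs)          ≡⟨ filter-absorb C′ (candidate? T) weaken xs ⟩
          filter C′ xs                                  ≡⟨ filter-absorb C′ _ (λ { ((_ , y∉) , _) refl → y∉ (∈-add⁺ T e) }) xs ⟨
          filter C′ (xs ∖ e)                            ∎
      ... | yes e∈X | no dep = greedyLoop-scan (suc k) T s (ℕP.m≤n⇒m≤1+n len) (fresh ∘ proj₁ ∘ ∈-filter⁻ _ {xs = xs})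
          (trans inv (sym (filter-absorb (candidate? T) _ (λ { (_ , i) refl → dep (independent (T ∪ ⁅ e ⁆) i) }) xs)))
      ... | no e∉X | _ = greedyLoop-scan (suc k) T s (ℕP.m≤n⇒m≤1+n len) (fresh ∘ proj₁ ∘ ∈-filter⁻ _ {xs = xs})
          (trans inv (sym (filter-absorb (candidate? T) _ (λ { ((e∈X , _) , _) refl → e∉X e∈X }) xs)))

      greedy-scan : GREEDY L w X ≡ scan X order ⊥
      greedy-scan = greedyLoop-scan n ⊥ order-sorted
        (ℕP.≤-reflexive (trans (sym (↭-length order-↭)) (length-tabulate id))) (λ _ → ∉⊥) refl

    private
      c : Subset n → ℚ
      c T = fromℕℚ ∣ T ∣

      c-add : ∀ {T x} → x ∉ T → c (T ∪ ⁅ x ⁆) * w x ≡ c T * w x + w x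
      c-add {T} {x} x∉ = begin
        c (T ∪ ⁅ x ⁆) * w x      ≡⟨ cong (λ k → fromℕℚ k * w x) (∣add∣ T x∉) ⟩
        fromℕℚ (suc ∣ T ∣) * w x ≡⟨ cong (_* w x) (fromℕℚ-suc ∣ T ∣) ⟩
        (1ℚ + c T) * w x         ≡⟨ solve 2 (λ a b → (con 1ℚ :+ a) :* b := a :* b :+ b) refl (c T) (w x) ⟩
        c T * w x + w x          ∎
        where
        open ≡-Reasoning
        open +-*-Solver

      -- One step of a scan at `x`: `a` is `w x` if `x` is taken and zero otherwise. The weight and
      -- the cardinality valued at `w x` grow by the same amount.
      Gain : Subset n → Subset n → Fin n → ℚ → Set
      Gain T T′ x a = f w T′ ≡ f w T + a × c T′ * w x ≡ c T * w x + a

      gain : ∀ {T x} → x ∉ T → Gain T (T ∪ ⁅ x ⁆) x (w x)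
      gain x∉ = f-add x∉ , c-add x∉

      no-gain : ∀ {T x} → Gain T T x 0ℚ
      no-gain = sym (ℚP.+-identityʳ _) , sym (ℚP.+-identityʳ _)

      -- The step contributes `a + b` to both sides, which cancels. Passing from `w x` back to `W`
      -- adds `c J * (W - w x)` on the left and `c I * (W - w x)` on the right, so `c J ≤ c I`
      -- preserves the inequality. This is one step of a summation by parts over the weights.
      lower-threshold : ∀ {F G I I′ J J′ x W a b} → Gain I I′ x a → Gain J J′ x b → c J ≤ c I → w x ≤ W →
        F + f w I′ + c J′ * w x ≤ G + f w J′ + c I′ * w x →
        F + f w I + c J * W ≤ G + f w J + c I * W
      lower-threshold {F} {G} {I} {I′} {J} {J′} {x} {W} {a} {b} (i₁ , i₂) (j₁ , j₂) cj≤ci x≤W ih = begin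
        F + f w I + c J * W
          ≡⟨ solve 7 (λ F i cj W x a b → F :+ i :+ cj :* W := F :+ (i :+ a) :+ (cj :* x :+ b) :+ (cj :* (W :- x) :- (a :+ b))) refl F (f w I) (c J) W (w x) a b ⟩
        F + (f w I + a) + (c J * w x + b) + (c J * (W - w x) - (a + b))
          ≡⟨ cong₂ (λ u v → F + u + v + (c J * (W - w x) - (a + b))) i₁ j₂ ⟨
        F + f w I′ + c J′ * w x + (c J * (W - w x) - (a + b))
          ≤⟨ ℚP.+-mono-≤ ih (ℚP.+-monoˡ-≤ (- (a + b)) (*-monoʳ (W - w x) (a≤b⇒0≤b-a x≤W) cj≤ci)) ⟩
        G + f w J′ + c I′ * w x + (c I * (W - w x) - (a + b))
          ≡⟨ cong₂ (λ u v → G + u + v + (c I * (W - w x) - (a + b))) j₁ i₂ ⟩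
        G + (f w J + b) + (c I * w x + a) + (c I * (W - w x) - (a + b))
          ≡⟨ solve 7 (λ F i cj W x a b → F :+ i :+ cj :* W := F :+ (i :+ b) :+ (cj :* x :+ a) :+ (cj :* (W :- x) :- (a :+ b))) refl G (f w J) (c I) W (w x) a b ⟨
        G + f w J + c I * W ∎
        where
        open ℚP.≤-Reasoning
        open +-*-Solver

    module _ (w≥0 : ∀ e → 0ℚ ≤ w e) where

      -- The surplus |I| - |J| is nonnegative throughout, and is valued at the current threshold weight W.
      scan-weight : ∀ H {I J xs l} W → 0ℚ ≤ W → Sorted xs l → (∀ {y} → y ∈ˡ xs → y ∉ I × y ∉ J) → Dominates I J →
        (∀ {y} → y ∈ˡ xs → w y ≤ W) →
        f w (scan H l J) + f w I + c J * W ≤ f w (scan ⊤ l I) + f w J + c I * W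
      scan-weight H {I} {J} W 0≤W [] fresh dom le =
        ℚP.+-mono-≤ (ℚP.≤-reflexive (ℚP.+-comm (f w J) (f w I))) (*-monoʳ W 0≤W (fromℕℚ-mono (dominates-∣∣ dom)))
      scan-weight H {I} {J} {xs} {x ∷ l} W 0≤W (beq ∷ s) fresh dom le = step
        where
        x∉I : x ∉ I
        x∉I = proj₁ (fresh (best-∈ beq))
        x∉J : x ∉ J
        x∉J = proj₂ (fresh (best-∈ beq))
        keep : ∀ {T y} → (∀ {y} → y ∈ˡ xs → y ∉ T) → y ∈ˡ xs ∖ x → y ∉ T
        keep fr y∈ = fr (proj₁ (∈-filter⁻ (λ y → ¬? (y FinP.≟ x)) {xs = xs} y∈))
        keep-add : ∀ {T y} → (∀ {y} → y ∈ˡ xs → y ∉ T) → y ∈ˡ xs ∖ x → y ∉ T ∪ ⁅ x ⁆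
        keep-add {T} fr y∈ y∈T with ∈-filter⁻ (λ y → ¬? (y FinP.≟ x)) {xs = xs} y∈
        ... | y∈xs , y≢x = fr y∈xs (∈-add⁻ T y∈T y≢x)
        next : ∀ {I′ J′ a b} → Gain I I′ x a → Gain J J′ x b →
          (∀ {y} → y ∈ˡ xs ∖ x → y ∉ I′) → (∀ {y} → y ∈ˡ xs ∖ x → y ∉ J′) → Dominates I′ J′ →
          f w (scan H l J′) + f w I + c J * W ≤ f w (scan ⊤ l I′) + f w J + c I * W
        next {I′} {J′} gI gJ fI fJ dom′ = lower-threshold {f w (scan H l J′)} {f w (scan ⊤ l I′)} {I} {I′} {J} {J′} gI gJ (fromℕℚ-mono (dominates-∣∣ dom)) (le (best-∈ beq))
          (scan-weight H (w x) (w≥0 x) s (λ y∈ → fI y∈ , fJ y∈) dom′ (best-max beq ∘ proj₁ ∘ ∈-filter⁻ (λ y → ¬? (y FinP.≟ x)) {xs = xs}))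
        fI : ∀ {y} → y ∈ˡ xs → y ∉ I
        fI = proj₁ ∘ fresh
        fJ : ∀ {y} → y ∈ˡ xs → y ∉ J
        fJ = proj₂ ∘ fresh
        step : f w (scan H (x ∷ l) J) + f w I + c J * W ≤ f w (scan ⊤ (x ∷ l) I) + f w J + c I * W
        step with x ∈? ⊤ {n} | ind? (I ∪ ⁅ x ⁆) | x ∈? H | ind? (J ∪ ⁅ x ⁆)
        ... | no x∉ | _ | _ | _ = contradiction ∈⊤ x∉
        ... | yes _ | yes iI | yes _ | yes iJ = next (gain x∉I) (gain x∉J) (keep-add fI) (keep-add fJ) (dom-add x dom iI iJ)
        ... | yes _ | yes iI | yes _ | no _   = next (gain x∉I) (no-gain {J}) (keep-add fI) (keep fJ) (dom-addˡ x dom iI)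
        ... | yes _ | yes iI | no _  | _      = next (gain x∉I) (no-gain {J}) (keep-add fI) (keep fJ) (dom-addˡ x dom iI)
        ... | yes _ | no dI  | yes _ | yes iJ = next (no-gain {I}) (gain x∉J) (keep fI) (keep-add fJ) (dom-addʳ x dom dI iJ)
        ... | yes _ | no _   | yes _ | no _   = next (no-gain {I}) (no-gain {J}) (keep fI) (keep fJ) dom
        ... | yes _ | no _   | no _  | _      = next (no-gain {I}) (no-gain {J}) (keep fI) (keep fJ) dom

      w≤∑ : ∀ {y} xs → y ∈ˡ xs → w y ≤ ∑ xs w
      w≤∑ (x ∷ xs) (here refl) = subst (_≤ w x + ∑ xs w) (ℚP.+-identityʳ (w x)) (ℚP.+-monoʳ-≤ (w x) (0≤∑ xs w≥0))
      w≤∑ (x ∷ xs) (there y∈) = ℚP.≤-trans (w≤∑ xs y∈) (subst (_≤ w x + ∑ xs w) (ℚP.+-identityˡ (∑ xs w)) (ℚP.+-monoˡ-≤ (∑ xs w) (w≥0 x)))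

      greedy-optimal : ∀ T → Independent L T → f w T ≤ f w (scan ⊤ order ⊥)
      greedy-optimal T iT = ℚP.≤-trans
        (f-mono w≥0 (scan-⊇-ind iT order ⊥ (λ y∈ → contradiction y∈ ∉⊥) λ {y} _ → inj₂ (∈-resp-↭ order-↭ (∈-allFin y))))
        (begin
          F                                 ≡⟨ cancel F ⟩
          F + z + k * W - (z + k * W)       ≤⟨ ℚP.+-monoˡ-≤ (- (z + k * W)) (scan-weight T W (0≤∑ (allFin n) w≥0) order-sorted (λ _ → ∉⊥ , ∉⊥) dominates-⊥ (w≤∑ (allFin n))) ⟩
          G + z + k * W - (z + k * W)       ≡⟨ cancel G ⟨
          G                                 ∎)
        where
        open ℚP.≤-Reasoning
        open +-*-Solver
        -- Any bound on all weights can serve as the first threshold: its terms cancel, because both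
        -- solutions start empty.
        W = ∑ (allFin n) w
        F = f w (scan T order ⊥)
        G = f w (scan ⊤ order ⊥)
        z = f w ⊥
        k = c ⊥
        cancel : ∀ F → F ≡ F + z + k * W - (z + k * W)
        cancel F = solve 4 (λ F z k W → F := F :+ z :+ k :* W :- (z :+ k :* W)) refl F z k W

-- Random order and independent coins

fromℕℚ-+ : ∀ a b → fromℕℚ (a ℕ.+ b) ≡ fromℕℚ a + fromℕℚ b
fromℕℚ-+ zero    b = sym (ℚP.+-identityˡ (fromℕℚ b))
fromℕℚ-+ (suc a) b = begin
  fromℕℚ (suc (a ℕ.+ b))        ≡⟨ fromℕℚ-suc (a ℕ.+ b) ⟩
  1ℚ + fromℕℚ (a ℕ.+ b)         ≡⟨ cong (λ z → 1ℚ + z) (fromℕℚ-+ a b) ⟩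
  1ℚ + (fromℕℚ a + fromℕℚ b)    ≡⟨ ℚP.+-assoc 1ℚ (fromℕℚ a) (fromℕℚ b) ⟨
  1ℚ + fromℕℚ a + fromℕℚ b      ≡⟨ cong (_+ fromℕℚ b) (fromℕℚ-suc a) ⟨
  fromℕℚ (suc a) + fromℕℚ b     ∎
  where open ≡-Reasoning

fromℕℚ-* : ∀ a b → fromℕℚ (a ℕ.* b) ≡ fromℕℚ a * fromℕℚ b
fromℕℚ-* zero    b = sym (ℚP.*-zeroˡ (fromℕℚ b))
fromℕℚ-* (suc a) b = begin
  fromℕℚ (b ℕ.+ a ℕ.* b)             ≡⟨ fromℕℚ-+ b (a ℕ.* b) ⟩
  fromℕℚ b + fromℕℚ (a ℕ.* b)        ≡⟨ cong (λ z → fromℕℚ b + z) (fromℕℚ-* a b) ⟩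
  fromℕℚ b + fromℕℚ a * fromℕℚ b     ≡⟨ solve 2 (λ a b → b :+ a :* b := (con 1ℚ :+ a) :* b) refl (fromℕℚ a) (fromℕℚ b) ⟩
  (1ℚ + fromℕℚ a) * fromℕℚ b         ≡⟨ cong (_* fromℕℚ b) (fromℕℚ-suc a) ⟨
  fromℕℚ (suc a) * fromℕℚ b          ∎
  where
  open ≡-Reasoning
  open +-*-Solver

1/k*k : ∀ k .{{_ : ℕ.NonZero k}} → (+ 1 / k) * fromℕℚ k ≡ 1ℚ
1/k*k (suc k) = ℚP.toℚᵘ-injective (begin
  toℚᵘ ((+ 1 / suc k) * fromℕℚ (suc k))          ≈⟨ ℚP.toℚᵘ-homo-* (+ 1 / suc k) (fromℕℚ (suc k)) ⟩
  toℚᵘ (+ 1 / suc k) ℚᵘ.* toℚᵘ (fromℕℚ (suc k))  ≈⟨ ℚᵘP.*-cong (ℚP.toℚᵘ-fromℚᵘ (mkℚᵘ (+ 1) k)) (ℚP.toℚᵘ-fromℚᵘ (mkℚᵘ (+ suc k) 0)) ⟩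
  mkℚᵘ (+ 1) k ℚᵘ.* mkℚᵘ (+ suc k) 0             ≈⟨ *≡* (trans (ℤP.*-identityʳ _) (trans (ℤP.*-identityˡ (+ suc k)) (sym (trans (ℤP.*-identityˡ _) (cong +_ (ℕP.*-identityʳ (suc k))))))) ⟩
  toℚᵘ 1ℚ                                        ∎)
  where
  open ℚᵘP.≃-Reasoning

fact : ℕ → ℚ
fact m = fromℕℚ (m !)

fact-suc : ∀ m → fact (suc m) ≡ fromℕℚ (suc m) * fact m
fact-suc m = fromℕℚ-* (suc m) (m !)

C-fact : ∀ {m n} → m ℕ.≤ n → fromℕℚ (n C m) * (fact m * fact (n ∸ m)) ≡ fact n
C-fact {m} {n} m≤n = begin
  fromℕℚ (n C m) * (fact m * fact (n ∸ m))        ≡⟨ cong (λ z → fromℕℚ (n C m) * z) (fromℕℚ-* (m !) ((n ∸ m) !)) ⟨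
  fromℕℚ (n C m) * fromℕℚ (m ! ℕ.* (n ∸ m) !)     ≡⟨ fromℕℚ-* (n C m) (m ! ℕ.* (n ∸ m) !) ⟨
  fromℕℚ ((n C m) ℕ.* (m ! ℕ.* (n ∸ m) !))          ≡⟨ cong fromℕℚ (trans (cong (ℕ._* (m ! ℕ.* (n ∸ m) !)) (nCk≡n!/k![n-k]! m≤n)) (DivMod.m/n*n≡m {{m ℕP.!* (n ∸ m) !≢0}} (k![n∸k]!∣n! m≤n))) ⟩
  fact n                                          ∎
  where open ≡-Reasoning

∑-+ : ∀ (l : List A) {g h : A → ℚ} → ∑ l (λ x → g x + h x) ≡ ∑ l g + ∑ l h
∑-+ []      = refl
∑-+ (x ∷ l) {g} {h} = trans (cong (λ z → g x + h x + z) (∑-+ l))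
  (solve 4 (λ a b c d → a :+ b :+ (c :+ d) := a :+ c :+ (b :+ d)) refl (g x) (h x) (∑ l g) (∑ l h))
  where open +-*-Solver

∑-*ˡ : ∀ (l : List A) c {g : A → ℚ} → ∑ l (λ x → c * g x) ≡ c * ∑ l g
∑-*ˡ []      c = sym (ℚP.*-zeroʳ c)
∑-*ˡ (x ∷ l) c {g} = trans (cong (λ z → c * g x + z) (∑-*ˡ l c)) (sym (ℚP.*-distribˡ-+ c (g x) (∑ l g)))

∑-swap : ∀ {B : Set} (l : List A) (m : List B) (g : A → B → ℚ) → ∑ l (λ x → ∑ m (g x)) ≡ ∑ m (λ y → ∑ l (λ x → g x y))
∑-swap []      m g = sym (∑-zero m)
∑-swap (x ∷ l) m g = trans (cong (λ z → ∑ m (g x) + z) (∑-swap l m g)) (sym (∑-+ m))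

∑-++ : ∀ (l m : List A) (g : A → ℚ) → ∑ (l ++ m) g ≡ ∑ l g + ∑ m g
∑-++ []      m g = sym (ℚP.+-identityˡ (∑ m g))
∑-++ (x ∷ l) m g = trans (cong (λ z → g x + z) (∑-++ l m g)) (sym (ℚP.+-assoc (g x) (∑ l g) (∑ m g)))

∑-map : ∀ {B : Set} (l : List A) (h : A → B) (g : B → ℚ) → ∑ (map h l) g ≡ ∑ l (g ∘ h)
∑-map []      h g = refl
∑-map (x ∷ l) h g = cong (λ z → g (h x) + z) (∑-map l h g)

∑-concatMap : ∀ {B : Set} (l : List A) (h : A → List B) (g : B → ℚ) → ∑ (concatMap h l) g ≡ ∑ l (λ x → ∑ (h x) g)
∑-concatMap []      h g = refl
∑-concatMap (x ∷ l) h g = trans (∑-++ (h x) (concatMap h l) g) (cong (λ z → ∑ (h x) g + z) (∑-concatMap l h g))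

sumℚ-∑ : ∀ (l : List A) (g : A → ℚ) → sumℚ (map g l) ≡ ∑ l g
sumℚ-∑ l g = trans (foldl-∑ id 0ℚ (map g l)) (trans (ℚP.+-identityˡ _) (∑-map l g id))

setOf : List (Fin n) → Subset n
setOf []      = ⊥
setOf (x ∷ l) = setOf l ∪ ⁅ x ⁆

∪-swapʳ : ∀ (S T U : Subset n) → (S ∪ T) ∪ U ≡ (S ∪ U) ∪ T
∪-swapʳ S T U = trans (∪-assoc S T U) (trans (cong (S ∪_) (∪-comm T U)) (sym (∪-assoc S U T)))

foldl-setOf : ∀ (S : Subset n) l → foldl (λ S e → S ∪ ⁅ e ⁆) S l ≡ S ∪ setOf l
foldl-setOf S []      = sym (∪-identityʳ S)
foldl-setOf S (x ∷ l) = trans (foldl-setOf (S ∪ ⁅ x ⁆) l) (trans (∪-swapʳ S ⁅ x ⁆ (setOf l)) (∪-assoc S (setOf l) ⁅ x ⁆))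

toSet-setOf : ∀ (l : List (Fin n)) → toSet l ≡ setOf l
toSet-setOf l = trans (foldl-setOf ⊥ l) (trans (∪-comm ⊥ (setOf l)) (∪-identityʳ (setOf l)))

insertions-↭ : ∀ {x : A} σ {τ} → τ ∈ˡ insertions x σ → τ ↭ x ∷ σ
insertions-↭ []      (here refl) = Perm.refl
insertions-↭ (y ∷ σ) (here refl) = Perm.refl
insertions-↭ {x = x} (y ∷ σ) (there τ∈) with ∈-map⁻ (y ∷_) τ∈
... | τ′ , τ′∈ , refl = ↭-trans (prep y (insertions-↭ σ τ′∈)) (swap y x Perm.refl)

permutations-↭ : ∀ (xs : List A) {σ} → σ ∈ˡ permutations xs → σ ↭ xs
permutations-↭ []       (here refl) = Perm.refl
permutations-↭ (x ∷ xs) σ∈ with find (∈-concatMap⁻ (insertions x) {xs = permutations xs} σ∈)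
... | τ , τ∈ , σ∈τ = ↭-trans (insertions-↭ τ σ∈τ) (prep x (permutations-↭ xs τ∈))

-- Of the m + j slots for x, the first m put x among the first m elements.
∑-insertions : ∀ (x : Fin n) σ (φ : Subset n → ℚ) m j → suc (length σ) ≡ m ℕ.+ j →
  ∑ (insertions x σ) (λ τ → φ (setOf (take m τ))) ≡
  fromℕℚ m * φ (setOf (take (pred m) σ) ∪ ⁅ x ⁆) + fromℕℚ j * φ (setOf (take m σ))
∑-insertions x [] φ zero (suc zero) refl =
  solve 2 (λ a b → b :+ con 0ℚ := con 0ℚ :* a :+ con 1ℚ :* b) refl (φ (⊥ ∪ ⁅ x ⁆)) (φ ⊥)
  where open +-*-Solver
∑-insertions x [] φ (suc zero) zero refl =
  solve 2 (λ a b → a :+ con 0ℚ := con 1ℚ :* a :+ con 0ℚ :* b) refl (φ (⊥ ∪ ⁅ x ⁆)) (φ ⊥)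
  where open +-*-Solver
∑-insertions x [] φ (suc zero) (suc j) ()
∑-insertions x (y ∷ σ) φ zero (suc j) eq = begin
  φ ⊥ + ∑ (map (y ∷_) (insertions x σ)) (λ τ → φ ⊥)          ≡⟨ cong (λ z → φ ⊥ + z) (∑-map (insertions x σ) (y ∷_) _) ⟩
  φ ⊥ + ∑ (insertions x σ) (λ τ → φ ⊥)                       ≡⟨ cong (λ z → φ ⊥ + z) (∑-insertions x σ φ zero j (ℕP.suc-injective eq)) ⟩
  φ ⊥ + (0ℚ * φ (⊥ ∪ ⁅ x ⁆) + fromℕℚ j * φ ⊥)                ≡⟨ solve 3 (λ a b j → b :+ (con 0ℚ :* a :+ j :* b) := con 0ℚ :* a :+ (con 1ℚ :+ j) :* b) refl (φ (⊥ ∪ ⁅ x ⁆)) (φ ⊥) (fromℕℚ j) ⟩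
  0ℚ * φ (⊥ ∪ ⁅ x ⁆) + (1ℚ + fromℕℚ j) * φ ⊥                 ≡⟨ cong (λ z → 0ℚ * φ (⊥ ∪ ⁅ x ⁆) + z * φ ⊥) (fromℕℚ-suc j) ⟨
  0ℚ * φ (⊥ ∪ ⁅ x ⁆) + fromℕℚ (suc j) * φ ⊥                  ∎
  where
  open ≡-Reasoning
  open +-*-Solver
∑-insertions x (y ∷ σ) φ (suc m) j eq = begin
  φx + ∑ (map (y ∷_) (insertions x σ)) (λ τ → φ (setOf (take (suc m) τ)))
    ≡⟨ cong (λ z → φx + z) (∑-map (insertions x σ) (y ∷_) _) ⟩
  φx + ∑ (insertions x σ) (λ τ → φ (setOf (take m τ) ∪ ⁅ y ⁆))
    ≡⟨ cong (λ z → φx + z) (∑-insertions x σ (λ S → φ (S ∪ ⁅ y ⁆)) m j (ℕP.suc-injective eq)) ⟩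
  φx + (fromℕℚ m * φ ((setOf (take (pred m) σ) ∪ ⁅ x ⁆) ∪ ⁅ y ⁆) + fromℕℚ j * φy)
    ≡⟨ cong (λ z → φx + (z + fromℕℚ j * φy)) (swapped m) ⟩
  φx + (fromℕℚ m * φx + fromℕℚ j * φy)
    ≡⟨ solve 4 (λ a b m j → a :+ (m :* a :+ j :* b) := (con 1ℚ :+ m) :* a :+ j :* b) refl φx φy (fromℕℚ m) (fromℕℚ j) ⟩
  (1ℚ + fromℕℚ m) * φx + fromℕℚ j * φy
    ≡⟨ cong (λ z → z * φx + fromℕℚ j * φy) (fromℕℚ-suc m) ⟨
  fromℕℚ (suc m) * φx + fromℕℚ j * φy ∎
  where
  open ≡-Reasoning
  open +-*-Solver
  φx = φ (setOf (take m (y ∷ σ)) ∪ ⁅ x ⁆)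
  φy = φ (setOf (take m σ) ∪ ⁅ y ⁆)
  -- For `m = 0` the coefficient kills both sides, so the value of `pred 0` is harmless; otherwise
  -- the two additions commute.
  swapped : ∀ m → fromℕℚ m * φ ((setOf (take (pred m) σ) ∪ ⁅ x ⁆) ∪ ⁅ y ⁆) ≡ fromℕℚ m * φ (setOf (take m (y ∷ σ)) ∪ ⁅ x ⁆)
  swapped zero    = trans (ℚP.*-zeroˡ (φ ((⊥ ∪ ⁅ x ⁆) ∪ ⁅ y ⁆))) (sym (ℚP.*-zeroˡ (φ (⊥ ∪ ⁅ x ⁆))))
  swapped (suc m) = cong (λ S → fromℕℚ (suc m) * φ S) (∪-swapʳ (setOf (take m σ)) ⁅ x ⁆ ⁅ y ⁆)

∑-subsets : ℕ → List (Fin n) → (Subset n → ℚ) → ℚ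
∑-subsets zero    l       φ = φ ⊥
∑-subsets (suc m) []      φ = 0ℚ
∑-subsets (suc m) (x ∷ l) φ = ∑-subsets m l (λ S → φ (S ∪ ⁅ x ⁆)) + ∑-subsets (suc m) l φ

∑-subsets-large : ∀ m (l : List (Fin n)) φ → length l ℕ.< m → ∑-subsets m l φ ≡ 0ℚ
∑-subsets-large (suc m) []      φ _         = refl
∑-subsets-large (suc m) (x ∷ l) φ (s≤s len) =
  cong₂ _+_ (∑-subsets-large m l _ len) (∑-subsets-large (suc m) l φ (ℕP.m≤n⇒m≤1+n len))

-- Every choice of `m` elements is the prefix of `m ! * j !` orders. Inserting the head `x` into an
-- order of the tail proves this: `m` slots put `x` into the prefix and leave `m - 1` places to the
-- others, and `j` slots put it behind.
∑-permutations : ∀ xs (φ : Subset n → ℚ) m j → length xs ≡ m ℕ.+ j →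
  ∑ (permutations xs) (λ σ → φ (setOf (take m σ))) ≡ fact m * fact j * ∑-subsets m xs φ
∑-permutations []       φ zero zero refl = trans (ℚP.+-identityʳ (φ ⊥)) (sym (ℚP.*-identityˡ (φ ⊥)))
∑-permutations (x ∷ xs) φ m j eq = begin
  ∑ (permutations (x ∷ xs)) (λ σ → φ (setOf (take m σ)))
    ≡⟨ ∑-concatMap (permutations xs) (insertions x) _ ⟩
  ∑ (permutations xs) (λ σ → ∑ (insertions x σ) (λ τ → φ (setOf (take m τ))))
    ≡⟨ ∑-cong (permutations xs) (λ {σ} σ∈ → ∑-insertions x σ φ m j (trans (cong suc (↭-length (permutations-↭ xs σ∈))) eq)) ⟩
  ∑ (permutations xs) (λ σ → fromℕℚ m * φ′ (setOf (take (pred m) σ)) + fromℕℚ j * φ (setOf (take m σ)))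
    ≡⟨ ∑-+ (permutations xs) ⟩
  ∑ (permutations xs) (λ σ → fromℕℚ m * φ′ (setOf (take (pred m) σ))) + ∑ (permutations xs) (λ σ → fromℕℚ j * φ (setOf (take m σ)))
    ≡⟨ cong₂ _+_ (∑-*ˡ (permutations xs) (fromℕℚ m)) (∑-*ˡ (permutations xs) (fromℕℚ j)) ⟩
  fromℕℚ m * P φ′ (pred m) + fromℕℚ j * P φ m
    ≡⟨ combine m j eq ⟩
  fact m * fact j * ∑-subsets m (x ∷ xs) φ ∎
  where
  open ≡-Reasoning
  open +-*-Solver
  φ′ = λ S → φ (S ∪ ⁅ x ⁆)
  P = λ (ψ : Subset _ → ℚ) k → ∑ (permutations xs) (λ σ → ψ (setOf (take k σ)))
  combine : ∀ m j → length (x ∷ xs) ≡ m ℕ.+ j →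
    fromℕℚ m * P φ′ (pred m) + fromℕℚ j * P φ m ≡ fact m * fact j * ∑-subsets m (x ∷ xs) φ
  combine zero (suc j) eq = begin
    0ℚ * P φ′ 0 + fromℕℚ (suc j) * P φ 0             ≡⟨ cong (λ z → 0ℚ * P φ′ 0 + fromℕℚ (suc j) * z) (∑-permutations xs φ 0 j (ℕP.suc-injective eq)) ⟩
    0ℚ * P φ′ 0 + fromℕℚ (suc j) * (1ℚ * fact j * s) ≡⟨ solve 4 (λ a k f s → con 0ℚ :* a :+ k :* (con 1ℚ :* f :* s) := con 1ℚ :* (k :* f) :* s) refl (P φ′ 0) (fromℕℚ (suc j)) (fact j) s ⟩
    1ℚ * (fromℕℚ (suc j) * fact j) * s               ≡⟨ cong (λ z → 1ℚ * z * s) (fact-suc j) ⟨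
    1ℚ * fact (suc j) * s                            ∎
    where s = φ ⊥
  combine (suc m) zero eq = begin
    fromℕℚ (suc m) * P φ′ m + 0ℚ * P φ (suc m)             ≡⟨ cong (λ z → fromℕℚ (suc m) * z + 0ℚ * P φ (suc m)) (∑-permutations xs φ′ m 0 (ℕP.suc-injective eq)) ⟩
    fromℕℚ (suc m) * (fact m * 1ℚ * s) + 0ℚ * P φ (suc m)  ≡⟨ solve 4 (λ a k f s → k :* (f :* con 1ℚ :* s) :+ con 0ℚ :* a := k :* f :* con 1ℚ :* (s :+ con 0ℚ)) refl (P φ (suc m)) (fromℕℚ (suc m)) (fact m) s ⟩
    fromℕℚ (suc m) * fact m * 1ℚ * (s + 0ℚ)                ≡⟨ cong₂ (λ a b → a * 1ℚ * (s + b)) (fact-suc m) (∑-subsets-large (suc m) xs φ (s≤s (ℕP.≤-reflexive (trans (ℕP.suc-injective eq) (ℕP.+-identityʳ m))))) ⟨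
    fact (suc m) * 1ℚ * (s + ∑-subsets (suc m) xs φ)       ∎
    where s = ∑-subsets m xs φ′
  combine (suc m) (suc j) eq = begin
    fromℕℚ (suc m) * P φ′ m + fromℕℚ (suc j) * P φ (suc m)
      ≡⟨ cong₂ (λ a b → fromℕℚ (suc m) * a + fromℕℚ (suc j) * b) (∑-permutations xs φ′ m (suc j) (ℕP.suc-injective eq)) (∑-permutations xs φ (suc m) j (trans (ℕP.suc-injective eq) (ℕP.+-suc m j))) ⟩
    fromℕℚ (suc m) * (fact m * fact (suc j) * s) + fromℕℚ (suc j) * (fact (suc m) * fact j * t)
      ≡⟨ solve 8 (λ m′ fm fsj s j′ fsm fj t → m′ :* (fm :* fsj :* s) :+ j′ :* (fsm :* fj :* t) := m′ :* fm :* fsj :* s :+ fsm :* (j′ :* fj) :* t) refl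
           (fromℕℚ (suc m)) (fact m) (fact (suc j)) s (fromℕℚ (suc j)) (fact (suc m)) (fact j) t ⟩
    fromℕℚ (suc m) * fact m * fact (suc j) * s + fact (suc m) * (fromℕℚ (suc j) * fact j) * t
      ≡⟨ cong₂ (λ a b → a * fact (suc j) * s + fact (suc m) * b * t) (fact-suc m) (fact-suc j) ⟨
    fact (suc m) * fact (suc j) * s + fact (suc m) * fact (suc j) * t
      ≡⟨ ℚP.*-distribˡ-+ (fact (suc m) * fact (suc j)) s t ⟨
    fact (suc m) * fact (suc j) * (s + t) ∎
    where
    s = ∑-subsets m xs φ′
    t = ∑-subsets (suc m) xs φ

-- conv k g is the sum of g m j over m + j = k.
conv : ℕ → (ℕ → ℕ → ℚ) → ℚ
conv zero    g = g 0 0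
conv (suc k) g = g 0 (suc k) + conv k (λ m j → g (suc m) j)

conv-applyUpTo : ∀ k (h : ℕ → ℕ) (G : ℕ → ℚ) g → (∀ i → G (h i) ≡ g i (k ∸ i)) → ∑ (applyUpTo h (suc k)) G ≡ conv k g
conv-applyUpTo zero    h G g eq = trans (ℚP.+-identityʳ _) (eq 0)
conv-applyUpTo (suc k) h G g eq = cong₂ _+_ (eq 0) (conv-applyUpTo k (h ∘ suc) G _ (eq ∘ suc))

conv-cong : ∀ k {g h} → (∀ m j → g m j ≡ h m j) → conv k g ≡ conv k h
conv-cong zero    eq = eq 0 0
conv-cong (suc k) eq = cong₂ _+_ (eq 0 (suc k)) (conv-cong k (λ m j → eq (suc m) j))

conv-+ : ∀ k {g h} → conv k (λ m j → g m j + h m j) ≡ conv k g + conv k h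
conv-+ zero = refl
conv-+ (suc k) {g} {h} = trans (cong (λ z → g 0 (suc k) + h 0 (suc k) + z) (conv-+ k))
  (solve 4 (λ a b c d → a :+ b :+ (c :+ d) := a :+ c :+ (b :+ d)) refl (g 0 (suc k)) (h 0 (suc k)) _ _)
  where open +-*-Solver

conv-*ˡ : ∀ k c {g} → conv k (λ m j → c * g m j) ≡ c * conv k g
conv-*ˡ zero    c = refl
conv-*ˡ (suc k) c {g} = trans (cong (λ z → c * g 0 (suc k) + z) (conv-*ˡ k c)) (sym (ℚP.*-distribˡ-+ c _ _))

-- `conv` splits off `m = 0`, which suits a coin showing heads; for tails the term with `j = 0` must
-- be split off instead.
conv-last : ∀ k g → conv (suc k) g ≡ conv k (λ m j → g m (suc j)) + g (suc k) 0
conv-last zero    g = refl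
conv-last (suc k) g = trans (cong (λ z → g 0 (suc (suc k)) + z) (conv-last k (λ m j → g (suc m) j))) (sym (ℚP.+-assoc (g 0 (suc (suc k))) _ _))

-- Independent coins and the binomial sample

module Coins (p q : ℚ) where

  -- Expectation of φ over the random subset containing each element of l independently with probability p.
  𝔼 : List (Fin n) → (Subset n → ℚ) → ℚ
  𝔼 []      φ = φ ⊥
  𝔼 (x ∷ l) φ = p * 𝔼 l (λ H → φ (H ∪ ⁅ x ⁆)) + q * 𝔼 l φ

  weighted : List (Fin n) → (Subset n → ℚ) → ℕ → ℕ → ℚ
  weighted l φ m j = p ^ℚ m * q ^ℚ j * ∑-subsets m l φ

  private
    with-x : Fin n → List (Fin n) → (Subset n → ℚ) → ℕ → ℚ
    with-x x l φ zero    = 0ℚ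
    with-x x l φ (suc m) = ∑-subsets m l (λ S → φ (S ∪ ⁅ x ⁆))

    ∑-subsets-∷ : ∀ m x (l : List (Fin n)) φ → ∑-subsets m (x ∷ l) φ ≡ with-x x l φ m + ∑-subsets m l φ
    ∑-subsets-∷ zero    x l φ = sym (ℚP.+-identityˡ (φ ⊥))
    ∑-subsets-∷ (suc m) x l φ = refl

  -- The `m`-element subsets are split by whether they contain `x`. Those that do lower `m` and
  -- release a factor `p`, the others lower `j` and release a factor `q`, which is the toss for `x`.
  -- The two boundary terms vanish: no empty set contains `x`, and `l` has no subset larger than
  -- itself.
  conv-weighted : ∀ (l : List (Fin n)) φ → conv (length l) (weighted l φ) ≡ 𝔼 l φ
  conv-weighted [] φ = ℚP.*-identityˡ (φ ⊥)
  conv-weighted (x ∷ l) φ = begin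
    conv (suc k) (weighted (x ∷ l) φ)
      ≡⟨ conv-cong (suc k) (λ m j → trans (cong (λ z → p ^ℚ m * q ^ℚ j * z) (∑-subsets-∷ m x l φ)) (ℚP.*-distribˡ-+ (p ^ℚ m * q ^ℚ j) (with-x x l φ m) (∑-subsets m l φ))) ⟩
    conv (suc k) (λ m j → p ^ℚ m * q ^ℚ j * with-x x l φ m + weighted l φ m j)
      ≡⟨ conv-+ (suc k) {λ m j → p ^ℚ m * q ^ℚ j * with-x x l φ m} {weighted l φ} ⟩
    conv (suc k) (λ m j → p ^ℚ m * q ^ℚ j * with-x x l φ m) + conv (suc k) (weighted l φ)
      ≡⟨ cong₂ _+_ heads tails ⟩
    p * 𝔼 l φ′ + q * 𝔼 l φ ∎
    where
    open ≡-Reasoning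
    open +-*-Solver
    k = length l
    φ′ = λ H → φ (H ∪ ⁅ x ⁆)
    rest = conv k (λ m j → p * p ^ℚ m * q ^ℚ j * ∑-subsets m l φ′)
    heads : conv (suc k) (λ m j → p ^ℚ m * q ^ℚ j * with-x x l φ m) ≡ p * 𝔼 l φ′
    heads = begin
      1ℚ * q ^ℚ suc k * 0ℚ + conv k (λ m j → p * p ^ℚ m * q ^ℚ j * ∑-subsets m l φ′)
        ≡⟨ trans (cong (_+ rest) (ℚP.*-zeroʳ (1ℚ * q ^ℚ suc k))) (ℚP.+-identityˡ rest) ⟩
      conv k (λ m j → p * p ^ℚ m * q ^ℚ j * ∑-subsets m l φ′)
        ≡⟨ conv-cong k (λ m j → solve 4 (λ p a b c → p :* a :* b :* c := p :* (a :* b :* c)) refl p (p ^ℚ m) (q ^ℚ j) (∑-subsets m l φ′)) ⟩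
      conv k (λ m j → p * weighted l φ′ m j)   ≡⟨ conv-*ˡ k p ⟩
      p * conv k (weighted l φ′)               ≡⟨ cong (λ z → p * z) (conv-weighted l φ′) ⟩
      p * 𝔼 l φ′                               ∎
    tails : conv (suc k) (weighted l φ) ≡ q * 𝔼 l φ
    tails = begin
      conv (suc k) (weighted l φ)              ≡⟨ conv-last k (weighted l φ) ⟩
      conv k (λ m j → p ^ℚ m * (q * q ^ℚ j) * ∑-subsets m l φ) + p ^ℚ suc k * 1ℚ * ∑-subsets (suc k) l φ
        ≡⟨ cong₂ _+_ (conv-cong k (λ m j → solve 4 (λ q a b c → a :* (q :* b) :* c := q :* (a :* b :* c)) refl q (p ^ℚ m) (q ^ℚ j) (∑-subsets m l φ)))
                     (trans (cong (λ z → p ^ℚ suc k * 1ℚ * z) (∑-subsets-large (suc k) l φ ℕP.≤-refl)) (ℚP.*-zeroʳ (p ^ℚ suc k * 1ℚ))) ⟩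
      conv k (λ m j → q * weighted l φ m j) + 0ℚ  ≡⟨ ℚP.+-identityʳ _ ⟩
      conv k (λ m j → q * weighted l φ m j)    ≡⟨ conv-*ˡ k q ⟩
      q * conv k (weighted l φ)                ≡⟨ cong (λ z → q * z) (conv-weighted l φ) ⟩
      q * 𝔼 l φ                                ∎

  module _ (p+q≡1 : p + q ≡ 1ℚ) (0≤p : 0ℚ ≤ p) (0≤q : 0ℚ ≤ q) where

    𝔼-mono : ∀ (l : List (Fin n)) {φ ψ} → (∀ H → (∀ {y} → y ∈ H → y ∈ˡ l) → φ H ≤ ψ H) → 𝔼 l φ ≤ 𝔼 l ψ
    𝔼-mono []      le = le ⊥ (λ y∈ → contradiction y∈ ∉⊥)
    𝔼-mono (x ∷ l) le = ℚP.+-mono-≤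
      (*-monoˡ p 0≤p (𝔼-mono l λ H H⊆l → le _ λ y∈ → member H H⊆l (x∈p∪q⁻ H _ y∈)))
      (*-monoˡ q 0≤q (𝔼-mono l λ H H⊆l → le H (there ∘ H⊆l)))
      where
      member : ∀ H → (∀ {y} → y ∈ H → y ∈ˡ l) → ∀ {y} → y ∈ H ⊎ y ∈ ⁅ x ⁆ → y ∈ˡ x ∷ l
      member H H⊆l (inj₁ y∈) = there (H⊆l y∈)
      member H H⊆l (inj₂ y∈) = here (x∈⁅y⁆⇒x≡y x y∈)

    𝔼-const : ∀ (l : List (Fin n)) c → 𝔼 l (λ _ → c) ≡ c
    𝔼-const []      c = refl
    𝔼-const (x ∷ l) c = begin
      p * 𝔼 l (λ _ → c) + q * 𝔼 l (λ _ → c)  ≡⟨ cong (λ z → p * z + q * z) (𝔼-const l c) ⟩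
      p * c + q * c                          ≡⟨ ℚP.*-distribʳ-+ c p q ⟨
      (p + q) * c                            ≡⟨ cong (_* c) p+q≡1 ⟩
      1ℚ * c                                 ≡⟨ ℚP.*-identityˡ c ⟩
      c                                      ∎
      where open ≡-Reasoning

    mix-≤ : ∀ {a b c} → a ≤ c → b ≤ c → p * a + q * b ≤ c
    mix-≤ {a} {b} {c} a≤c b≤c = subst (p * a + q * b ≤_)
      (trans (sym (ℚP.*-distribʳ-+ c p q)) (trans (cong (_* c) p+q≡1) (ℚP.*-identityˡ c)))
      (ℚP.+-mono-≤ (*-monoˡ p 0≤p a≤c) (*-monoˡ q 0≤q b≤c))

  𝔼-+ : ∀ (l : List (Fin n)) {φ ψ} → 𝔼 l (λ H → φ H + ψ H) ≡ 𝔼 l φ + 𝔼 l ψ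
  𝔼-+ []      = refl
  𝔼-+ (x ∷ l) {φ} {ψ} = trans (cong₂ (λ a b → p * a + q * b) (𝔼-+ l) (𝔼-+ l))
    (solve 6 (λ p q a b c d → p :* (a :+ b) :+ q :* (c :+ d) := (p :* a :+ q :* c) :+ (p :* b :+ q :* d)) refl p q _ _ (𝔼 l φ) (𝔼 l ψ))
    where open +-*-Solver

  𝔼-*ˡ : ∀ (l : List (Fin n)) c {φ} → 𝔼 l (λ H → c * φ H) ≡ c * 𝔼 l φ
  𝔼-*ˡ []      c = refl
  𝔼-*ˡ (x ∷ l) c {φ} = trans (cong₂ (λ a b → p * a + q * b) (𝔼-*ˡ l c) (𝔼-*ˡ l c))
    (solve 5 (λ p q c a b → p :* (c :* a) :+ q :* (c :* b) := c :* (p :* a :+ q :* b)) refl p q c _ (𝔼 l φ))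
    where open +-*-Solver

  𝔼-zero : ∀ (l : List (Fin n)) → 𝔼 l (λ _ → 0ℚ) ≡ 0ℚ
  𝔼-zero []      = refl
  𝔼-zero (x ∷ l) = trans (cong (λ z → p * z + q * z) (𝔼-zero l)) (trans (cong₂ _+_ (ℚP.*-zeroʳ p) (ℚP.*-zeroʳ q)) refl)

  𝔼-∑ : ∀ (l : List (Fin n)) (es : List A) (φ : A → Subset n → ℚ) → 𝔼 l (λ H → ∑ es (λ e → φ e H)) ≡ ∑ es (λ e → 𝔼 l (φ e))
  𝔼-∑ l []       φ = 𝔼-zero l
  𝔼-∑ l (e ∷ es) φ = trans (𝔼-+ l) (cong (λ z → 𝔼 l (φ e) + z) (𝔼-∑ l es φ))

  𝔼-cong : ∀ (l : List (Fin n)) {φ ψ} → (∀ H → φ H ≡ ψ H) → 𝔼 l φ ≡ 𝔼 l ψ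
  𝔼-cong []      eq = eq ⊥
  𝔼-cong (x ∷ l) eq = cong₂ (λ a b → p * a + q * b) (𝔼-cong l λ H → eq _) (𝔼-cong l eq)

  -- The tosses can be made in any order. This is used to toss for `e` first and for the others by
  -- decreasing weight.
  𝔼-↭ : ∀ {l m : List (Fin n)} → l ↭ m → ∀ φ → 𝔼 l φ ≡ 𝔼 m φ
  𝔼-↭ Perm.refl φ = refl
  𝔼-↭ (prep x l↭m) φ = cong₂ (λ a b → p * a + q * b) (𝔼-↭ l↭m _) (𝔼-↭ l↭m φ)
  𝔼-↭ (swap {xs = l} {ys = m} x y l↭m) φ = begin
    p * (p * 𝔼 l (λ H → φ ((H ∪ ⁅ y ⁆) ∪ ⁅ x ⁆)) + q * 𝔼 l (λ H → φ (H ∪ ⁅ x ⁆))) + q * (p * 𝔼 l (λ H → φ (H ∪ ⁅ y ⁆)) + q * 𝔼 l φ)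
      ≡⟨ solve 6 (λ p q a b c d → p :* (p :* a :+ q :* b) :+ q :* (p :* c :+ q :* d) := p :* (p :* a :+ q :* c) :+ q :* (p :* b :+ q :* d)) refl p q _ _ _ _ ⟩
    p * (p * 𝔼 l (λ H → φ ((H ∪ ⁅ y ⁆) ∪ ⁅ x ⁆)) + q * 𝔼 l (λ H → φ (H ∪ ⁅ y ⁆))) + q * (p * 𝔼 l (λ H → φ (H ∪ ⁅ x ⁆)) + q * 𝔼 l φ)
      ≡⟨ cong₂ (λ a b → p * a + q * b)
           (cong₂ (λ a b → p * a + q * b) (trans (𝔼-cong l λ H → cong φ (∪-swapʳ H ⁅ y ⁆ ⁅ x ⁆)) (𝔼-↭ l↭m _)) (𝔼-↭ l↭m _))
           (cong₂ (λ a b → p * a + q * b) (𝔼-↭ l↭m _) (𝔼-↭ l↭m φ)) ⟩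
    p * (p * 𝔼 m (λ H → φ ((H ∪ ⁅ x ⁆) ∪ ⁅ y ⁆)) + q * 𝔼 m (λ H → φ (H ∪ ⁅ y ⁆))) + q * (p * 𝔼 m (λ H → φ (H ∪ ⁅ x ⁆)) + q * 𝔼 m φ) ∎
    where
    open ≡-Reasoning
    open +-*-Solver
  𝔼-↭ (Perm.trans l↭k k↭m) φ = trans (𝔼-↭ l↭k φ) (𝔼-↭ k↭m φ)

  -- Since `C-fact` cancels the `n !` orders, cutting a random order at a binomial position gives a
  -- sample of `m` elements the weight `p ^ m * q ^ (n - m)`, that is, independent coins. The
  -- coefficient `b` is abstract because `binom` is written with `1ℚ - p` in place of `q`.
  ∑-permutations-binom : ∀ n φ (b : ℕ → ℚ) → (∀ m → b m ≡ fromℕℚ (n C m) * (p ^ℚ m * q ^ℚ (n ∸ m))) →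
    (+ 1 / (n !)) {{n ℕP.!≢0}} * ∑ (permutations (allFin n)) (λ σ → ∑ (upTo (suc n)) (λ m → b m * φ (setOf (take m σ)))) ≡ 𝔼 (allFin n) φ
  ∑-permutations-binom n φ b beq = begin
    1/n! * ∑ perms (λ σ → ∑ (upTo (suc n)) (λ m → b m * φ (setOf (take m σ))))
      ≡⟨ cong (λ z → 1/n! * z) (∑-swap perms (upTo (suc n)) _) ⟩
    1/n! * ∑ (upTo (suc n)) (λ m → ∑ perms (λ σ → b m * φ (setOf (take m σ))))
      ≡⟨ cong (λ z → 1/n! * z) (∑-cong (upTo (suc n)) λ {m} m∈ → term m (ℕP.≤-pred (∈-upTo⁻ m∈))) ⟩
    1/n! * ∑ (upTo (suc n)) (λ m → fact n * weighted (allFin n) φ m (n ∸ m))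
      ≡⟨ cong (λ z → 1/n! * z) (∑-*ˡ (upTo (suc n)) (fact n)) ⟩
    1/n! * (fact n * ∑ (upTo (suc n)) (λ m → weighted (allFin n) φ m (n ∸ m)))
      ≡⟨ ℚP.*-assoc 1/n! (fact n) _ ⟨
    1/n! * fact n * ∑ (upTo (suc n)) (λ m → weighted (allFin n) φ m (n ∸ m))
      ≡⟨ cong₂ _*_ (1/k*k (n !) {{n ℕP.!≢0}}) (conv-applyUpTo n id _ (weighted (allFin n) φ) (λ _ → refl)) ⟩
    1ℚ * conv n (weighted (allFin n) φ)
      ≡⟨ ℚP.*-identityˡ _ ⟩
    conv n (weighted (allFin n) φ)
      ≡⟨ cong (λ k → conv k (weighted (allFin n) φ)) (length-tabulate {n = n} id) ⟨
    conv (length (allFin n)) (weighted (allFin n) φ)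
      ≡⟨ conv-weighted (allFin n) φ ⟩
    𝔼 (allFin n) φ ∎
    where
    open ≡-Reasoning
    open +-*-Solver
    1/n! = (+ 1 / (n !)) {{n ℕP.!≢0}}
    perms = permutations (allFin n)
    term : ∀ m → m ℕ.≤ n → ∑ perms (λ σ → b m * φ (setOf (take m σ))) ≡ fact n * weighted (allFin n) φ m (n ∸ m)
    term m m≤n = begin
      ∑ perms (λ σ → b m * φ (setOf (take m σ)))
        ≡⟨ ∑-*ˡ perms (b m) ⟩
      b m * ∑ perms (λ σ → φ (setOf (take m σ)))
        ≡⟨ cong₂ _*_ (beq m) (∑-permutations (allFin n) φ m (n ∸ m) (trans (length-tabulate {n = n} id) (sym (ℕP.m+[n∸m]≡n m≤n)))) ⟩
      fromℕℚ (n C m) * (p ^ℚ m * q ^ℚ (n ∸ m)) * (fact m * fact (n ∸ m) * s)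
        ≡⟨ solve 5 (λ c pq a b s → c :* pq :* (a :* b :* s) := c :* (a :* b) :* (pq :* s)) refl (fromℕℚ (n C m)) (p ^ℚ m * q ^ℚ (n ∸ m)) (fact m) (fact (n ∸ m)) s ⟩
      fromℕℚ (n C m) * (fact m * fact (n ∸ m)) * (p ^ℚ m * q ^ℚ (n ∸ m) * s)
        ≡⟨ cong (_* (p ^ℚ m * q ^ℚ (n ∸ m) * s)) (C-fact m≤n) ⟩
      fact n * weighted (allFin n) φ m (n ∸ m) ∎
      where s = ∑-subsets m (allFin n) φ

-- Tails before heads

-- The probability of t tails before h heads, for a coin with heads probability p and tails probability q.
tailsFirst : (p q : ℚ) → ℕ → ℕ → ℚ
tailsFirst p q h       zero    = 1ℚ
tailsFirst p q zero    (suc t) = 0ℚ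
tailsFirst p q (suc h) (suc t) = p * tailsFirst p q h (suc t) + q * tailsFirst p q (suc h) t

0≤tailsFirst : ∀ {p q} → 0ℚ ≤ p → 0ℚ ≤ q → ∀ h t → 0ℚ ≤ tailsFirst p q h t
0≤tailsFirst 0≤p 0≤q h       zero    = 0≤1
0≤tailsFirst 0≤p 0≤q zero    (suc t) = ℚP.≤-refl
0≤tailsFirst 0≤p 0≤q (suc h) (suc t) = ℚP.+-mono-≤ {0ℚ} {_} {0ℚ}
  (0≤* 0≤p (0≤tailsFirst 0≤p 0≤q h (suc t))) (0≤* 0≤q (0≤tailsFirst 0≤p 0≤q (suc h) t))

5/6ℚ 1/6ℚ 5/9ℚ 1/3ℚ 5/3ℚ : ℚ
5/6ℚ = + 5 / 6
1/6ℚ = + 1 / 6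
5/9ℚ = + 5 / 9
1/3ℚ = + 1 / 3
5/3ℚ = + 5 / 3

0≤1/6 : 0ℚ ≤ 1/6ℚ
0≤1/6 = from-yes (0ℚ ℚP.≤? 1/6ℚ)

0≤5/6 : 0ℚ ≤ 5/6ℚ
0≤5/6 = from-yes (0ℚ ℚP.≤? 5/6ℚ)

private
  G : ℕ → ℕ → ℚ
  G = tailsFirst 5/6ℚ 1/6ℚ

  1≤^ : ∀ k → 1ℚ ≤ 5/3ℚ ^ℚ k
  1≤^ zero = ℚP.≤-refl
  1≤^ (suc k) = ℚP.≤-trans (from-yes (1ℚ ℚP.≤? 5/3ℚ * 1ℚ)) (*-monoˡ 5/3ℚ (from-yes (0ℚ ℚP.≤? 5/3ℚ)) (1≤^ k))

  0≤1/3 : 0ℚ ≤ 1/3ℚ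
  0≤1/3 = from-yes (0ℚ ℚP.≤? 1/3ℚ)

  -- a^h b^t solves the recurrence when p / a + q / b = 1; a = 5/3 = 2 p and b = 1/3 = 2 q minimise a b.
  G-bound : ∀ h t → G (suc h) t ≤ 5/3ℚ ^ℚ h * 1/3ℚ ^ℚ t
  G-bound h zero = subst (1ℚ ≤_) (sym (ℚP.*-identityʳ (5/3ℚ ^ℚ h))) (1≤^ h)
  G-bound zero (suc t) = begin
    5/6ℚ * 0ℚ + 1/6ℚ * G 1 t       ≤⟨ ℚP.+-monoʳ-≤ (5/6ℚ * 0ℚ) (*-monoˡ 1/6ℚ 0≤1/6 (G-bound zero t)) ⟩
    5/6ℚ * 0ℚ + 1/6ℚ * (1ℚ * v)    ≡⟨ solve 1 (λ v → con 5/6ℚ :* con 0ℚ :+ con 1/6ℚ :* (con 1ℚ :* v) := con 1/6ℚ :* v) refl v ⟩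
    1/6ℚ * v                       ≤⟨ *-monoʳ v (0≤^ 0≤1/3 t) (from-yes (1/6ℚ ℚP.≤? 1/3ℚ)) ⟩
    1/3ℚ * v                       ≡⟨ ℚP.*-identityˡ (1/3ℚ * v) ⟨
    1ℚ * (1/3ℚ * v)                ∎
    where
    open ℚP.≤-Reasoning
    open +-*-Solver
    v = 1/3ℚ ^ℚ t
  G-bound (suc h) (suc t) = begin
    5/6ℚ * G (suc h) (suc t) + 1/6ℚ * G (suc (suc h)) t
      ≤⟨ ℚP.+-mono-≤ (*-monoˡ 5/6ℚ 0≤5/6 (G-bound h (suc t))) (*-monoˡ 1/6ℚ 0≤1/6 (G-bound (suc h) t)) ⟩
    5/6ℚ * (u * (1/3ℚ * v)) + 1/6ℚ * (5/3ℚ * u * v)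
      ≡⟨ solve 2 (λ u v → con 5/6ℚ :* (u :* (con 1/3ℚ :* v)) :+ con 1/6ℚ :* (con 5/3ℚ :* u :* v) := con 5/3ℚ :* u :* (con 1/3ℚ :* v)) refl u v ⟩
    5/3ℚ * u * (1/3ℚ * v) ∎
    where
    open ℚP.≤-Reasoning
    open +-*-Solver
    u = 5/3ℚ ^ℚ h
    v = 1/3ℚ ^ℚ t

  ^-merge : ∀ i → 5/3ℚ ^ℚ i * 1/3ℚ ^ℚ i ≡ 5/9ℚ ^ℚ i
  ^-merge zero = refl
  ^-merge (suc i) = trans
    (solve 2 (λ x y → con 5/3ℚ :* x :* (con 1/3ℚ :* y) := con 5/9ℚ :* (x :* y)) refl (5/3ℚ ^ℚ i) (1/3ℚ ^ℚ i))
    (cong (λ z → 5/9ℚ * z) (^-merge i))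
    where open +-*-Solver

  -- The ratio `5/3 * 1/3 = 5/9` is `4 p q`.
  diagonal : ∀ i → G (suc i) (suc i) ≤ 1/3ℚ * 5/9ℚ ^ℚ i
  diagonal i = ℚP.≤-trans (G-bound i (suc i)) (ℚP.≤-reflexive (trans
    (solve 2 (λ x y → x :* (con 1/3ℚ :* y) := con 1/3ℚ :* (x :* y)) refl (5/3ℚ ^ℚ i) (1/3ℚ ^ℚ i))
    (cong (λ z → 1/3ℚ * z) (^-merge i))))
    where open +-*-Solver

  ∑G : ℕ → ℚ
  ∑G M = ∑ (downFrom M) (λ i → G (suc i) (suc i))

  -- κ (5/9)^j is the sum of the geometric bounds from index 4 + j on.
  κ : ℚ
  κ = (+ 3 / 4) * 5/9ℚ ^ℚ 4

  -- Because `1/3 * (5/9)^4 + κ * 5/9 = κ`, a new term and the shrunken remainder together never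
  -- exceed the old remainder.
  ∑G-tail : ∀ j → ∑G (4 ℕ.+ j) + κ * 5/9ℚ ^ℚ j ≤ + 3 / 8
  -- The geometric bound on all terms would give only `3/4`, so the first four probabilities are
  -- computed exactly; with three the total would still exceed `3/8`.
  ∑G-tail zero = from-yes (∑G 4 + κ * 1ℚ ℚP.≤? + 3 / 8)
  ∑G-tail (suc j) = begin
    ∑G (4 ℕ.+ suc j) + κ * (5/9ℚ * r)    ≡⟨ cong (λ k → ∑G k + κ * (5/9ℚ * r)) 4+1+j ⟩
    G (5 ℕ.+ j) (5 ℕ.+ j) + s + κ * (5/9ℚ * r)
      ≤⟨ ℚP.+-monoˡ-≤ (κ * (5/9ℚ * r)) (ℚP.+-monoˡ-≤ s (diagonal (4 ℕ.+ j))) ⟩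
    1/3ℚ * (5/9ℚ * (5/9ℚ * (5/9ℚ * (5/9ℚ * r)))) + s + κ * (5/9ℚ * r)
      ≡⟨ solve 2 (λ s r → con 1/3ℚ :* (con 5/9ℚ :* (con 5/9ℚ :* (con 5/9ℚ :* (con 5/9ℚ :* r)))) :+ s :+ con κ :* (con 5/9ℚ :* r) := s :+ con κ :* r) refl s r ⟩
    s + κ * r  ≤⟨ ∑G-tail j ⟩
    + 3 / 8 ∎
    where
    open ℚP.≤-Reasoning
    open +-*-Solver
    r = 5/9ℚ ^ℚ j
    s = ∑G (4 ℕ.+ j)
    4+1+j : 4 ℕ.+ suc j ≡ 5 ℕ.+ j
    4+1+j = ℕP.+-suc 4 j

  ∑G-step : ∀ M → ∑G M ≤ ∑G (suc M)
  ∑G-step M = subst (_≤ ∑G (suc M)) (ℚP.+-identityˡ (∑G M)) (ℚP.+-monoˡ-≤ (∑G M) (0≤tailsFirst 0≤5/6 0≤1/6 (suc M) (suc M)))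

∑-tailsFirst : ∀ M → ∑ (downFrom M) (λ i → tailsFirst 5/6ℚ 1/6ℚ (suc i) (suc i)) ≤ + 3 / 8
∑-tailsFirst M = begin
  -- Four more nonnegative terms bring any `M` into the range of `∑G-tail`.
  ∑G M                              ≤⟨ ℚP.≤-trans (∑G-step M) (ℚP.≤-trans (∑G-step (1 ℕ.+ M)) (ℚP.≤-trans (∑G-step (2 ℕ.+ M)) (∑G-step (3 ℕ.+ M)))) ⟩
  ∑G (4 ℕ.+ M)                      ≡⟨ ℚP.+-identityʳ (∑G (4 ℕ.+ M)) ⟨
  ∑G (4 ℕ.+ M) + 0ℚ                 ≤⟨ ℚP.+-monoʳ-≤ (∑G (4 ℕ.+ M)) 0≤tail ⟩
  ∑G (4 ℕ.+ M) + κ * 5/9ℚ ^ℚ M      ≤⟨ ∑G-tail M ⟩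
  + 3 / 8                          ∎
  where
  open ℚP.≤-Reasoning
  0≤tail : 0ℚ ≤ κ * 5/9ℚ ^ℚ M
  0≤tail = 0≤* (from-yes (0ℚ ℚP.≤? κ)) (0≤^ (from-yes (0ℚ ℚP.≤? 5/9ℚ)) M)

-- The online algorithm

Unique-resp-↭ : ∀ {xs ys : List A} → xs ↭ ys → Unique xs → Unique ys
Unique-resp-↭ {A = A} xs↭ys = PermSetoid.Unique-resp-↭ (setoid A) (↭⇒↭ₛ xs↭ys)

Unique-++⁻ʳ : ∀ (xs : List A) {ys} → Unique (xs ++ ys) → Unique ys
Unique-++⁻ʳ []       u       = u
Unique-++⁻ʳ (x ∷ xs) (_ ∷ u) = Unique-++⁻ʳ xs u

Unique-++-disjoint : ∀ (xs : List A) {ys x} → Unique (xs ++ ys) → x ∈ˡ xs → x ∉ˡ ys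
Unique-++-disjoint (x ∷ xs) (x≢ ∷ _) (here refl) x∈ys = All.lookup x≢ (∈-++⁺ʳ xs x∈ys) refl
Unique-++-disjoint (_ ∷ xs) (_ ∷ u)  (there x∈)  x∈ys = Unique-++-disjoint xs u x∈ x∈ys

∈-setOf⁺ : ∀ {x : Fin n} {l} → x ∈ˡ l → x ∈ setOf l
∈-setOf⁺ {l = _ ∷ l} (here refl) = ∈-add⁺ (setOf l) _
∈-setOf⁺ {l = _ ∷ l} (there x∈) = x∈p∪q⁺ (inj₁ (∈-setOf⁺ x∈))

∈-setOf⁻ : ∀ {x : Fin n} l → x ∈ setOf l → x ∈ˡ l
∈-setOf⁻ []      x∈ = contradiction x∈ ∉⊥
∈-setOf⁻ (y ∷ l) x∈ with x∈p∪q⁻ (setOf l) _ x∈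
... | inj₁ x∈l = there (∈-setOf⁻ l x∈l)
... | inj₂ x∈y = here (x∈⁅y⁆⇒x≡y y x∈y)

atLeast : ℕ → ℕ → ℚ
atLeast zero    k       = 1ℚ
atLeast (suc t) zero    = 0ℚ
atLeast (suc t) (suc k) = atLeast t k

0≤atLeast : ∀ t k → 0ℚ ≤ atLeast t k
0≤atLeast zero    k       = 0≤1
0≤atLeast (suc t) zero    = ℚP.≤-refl
0≤atLeast (suc t) (suc k) = 0≤atLeast t k

atLeast-mono : ∀ t {j k} → j ℕ.≤ k → atLeast t j ≤ atLeast t k
atLeast-mono zero    _         = ℚP.≤-refl
atLeast-mono (suc t) {k = k} z≤n = 0≤atLeast (suc t) k
atLeast-mono (suc t) (s≤s j≤k) = atLeast-mono t j≤k

atLeast-≡1 : ∀ {t k} → t ℕ.≤ k → atLeast t k ≡ 1ℚ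
atLeast-≡1 z≤n       = refl
atLeast-≡1 (s≤s t≤k) = atLeast-≡1 t≤k

-- The union bound before expectations are taken: one count reaching its capacity already makes the
-- sum of indicators at least 1.
all-below-or-1≤∑ : ∀ M (k : ℕ → ℕ) →
  (∀ {i} → i ℕ.< M → k i ℕ.< suc i) ⊎ 1ℚ ≤ ∑ (downFrom M) (λ i → atLeast (suc i) (k i))
all-below-or-1≤∑ zero k = inj₁ λ ()
all-below-or-1≤∑ (suc M) k with suc M ℕ.≤? k M | all-below-or-1≤∑ M k
... | yes M<k | _ = inj₂ (ℚP.+-mono-≤ {1ℚ} {_} {0ℚ} (ℚP.≤-reflexive (sym (atLeast-≡1 M<k))) (0≤∑ (downFrom M) λ i → 0≤atLeast (suc i) (k i)))
... | no _ | inj₂ 1≤ = inj₂ (ℚP.+-mono-≤ {0ℚ} {_} {1ℚ} (0≤atLeast (suc M) (k M)) 1≤)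
... | no M≮k | inj₁ below = inj₁ λ { (s≤s i≤M) → case (ℕP.m≤n⇒m<n∨m≡n i≤M) }
  where
  case : ∀ {i} → i ℕ.< M ⊎ i ≡ M → k i ℕ.< suc i
  case (inj₁ i<M)  = below i<M
  case (inj₂ refl) = ℕP.≰⇒> M≮k

-- Addable elements of one member against coin tosses

module Tails (L : Laminar n) (p q : ℚ) (p+q≡1 : p + q ≡ 1ℚ) (0≤p : 0ℚ ≤ p) (0≤q : 0ℚ ≤ q) where
  open Matroid L
  open Coins p q

  addable-∈ : ∀ {H x l T} → x ∈ H → Independent L (T ∪ ⁅ x ⁆) → addable H (x ∷ l) T ≡ addable H l (T ∪ ⁅ x ⁆)
  addable-∈ {H} {x} {T = T} x∈ i with x ∈? H | ind? (T ∪ ⁅ x ⁆)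
  ... | yes _ | yes _ = refl
  ... | no x∉ | _     = contradiction x∈ x∉
  ... | yes _ | no d  = contradiction i d

  addable-∉ : ∀ {H x l T} → x ∉ H → Independent L (T ∪ ⁅ x ⁆) → addable H (x ∷ l) T ≡ addable H l T ∪ ⁅ x ⁆
  addable-∉ {H} {x} {T = T} x∉ i with x ∈? H | ind? (T ∪ ⁅ x ⁆)
  ... | no _   | yes _ = refl
  ... | yes x∈ | _     = contradiction x∈ x∉
  ... | no _   | no d  = contradiction i d

  addable-dep : ∀ H x l T → ¬ Independent L (T ∪ ⁅ x ⁆) → addable H (x ∷ l) T ≡ addable H l T
  addable-dep H x l T d with x ∈? H | ind? (T ∪ ⁅ x ⁆)
  ... | yes _ | no _  = refl
  ... | no _  | no _  = refl
  ... | _     | yes i = contradiction i d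

  addable-add : ∀ {H x l} T → x ∉ˡ l → addable (H ∪ ⁅ x ⁆) l T ≡ addable H l T
  addable-add {H} {x} {l} T x∉ = addable-cong l T λ y∈ → (λ y∈H → ∈-add⁻ H y∈H λ { refl → x∉ y∈ }) , p⊆p∪q ⁅ x ⁆

  -- Each scanned element of B that could be added is a head, which uses up capacity, or a tail.
  tail-bound : ∀ {B μ} → (∀ T → Independent L T → ∣ T ∩ B ∣ ℕ.≤ μ) →
    ∀ l T h t → Unique l → (∀ {y} → y ∈ˡ l → y ∉ T) → μ ℕ.≤ ∣ T ∩ B ∣ ℕ.+ h →
    𝔼 l (λ H → atLeast t ∣ addable H l T ∩ B ∣) ≤ tailsFirst p q h t
  tail-bound cap l T h zero _ _ _ = ℚP.≤-reflexive (𝔼-const p+q≡1 0≤p 0≤q l 1ℚ)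
  tail-bound {B} cap [] T h (suc t) _ _ _ rewrite ∩-zeroˡ B | ∣⊥∣≡0 n = 0≤tailsFirst 0≤p 0≤q h (suc t)
  tail-bound {B} {μ} cap (x ∷ l) T h (suc t) (x≢ ∷ u) fresh room = step (ind? (T ∪ ⁅ x ⁆)) (x ∈? B)
    where
    x∉l : x ∉ˡ l
    x∉l x∈ = All.lookup x≢ x∈ refl
    x∉T : x ∉ T
    x∉T = fresh (here refl)
    fresh′ : ∀ {y} → y ∈ˡ l → y ∉ T ∪ ⁅ x ⁆
    fresh′ y∈ y∈T = fresh (there y∈) (∈-add⁻ T y∈T λ { refl → x∉l y∈ })
    mono : ∀ {φ ψ} → (∀ H → (∀ {y} → y ∈ H → y ∈ˡ l) → φ H ≤ ψ H) → 𝔼 l φ ≤ 𝔼 l ψ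
    mono = 𝔼-mono p+q≡1 0≤p 0≤q l
    heads = 𝔼 l (λ H → atLeast (suc t) ∣ addable (H ∪ ⁅ x ⁆) (x ∷ l) T ∩ B ∣)
    tails = 𝔼 l (λ H → atLeast (suc t) ∣ addable H (x ∷ l) T ∩ B ∣)
    heads-ind : Independent L (T ∪ ⁅ x ⁆) → heads ≤ 𝔼 l (λ H → atLeast (suc t) ∣ addable H l (T ∪ ⁅ x ⁆) ∩ B ∣)
    heads-ind i = mono λ H _ → ℚP.≤-reflexive (cong (λ S → atLeast (suc t) ∣ S ∩ B ∣)
      (trans (addable-∈ (∈-add⁺ H x) i) (addable-add (T ∪ ⁅ x ⁆) x∉l)))
    step : Dec (Independent L (T ∪ ⁅ x ⁆)) → Dec (x ∈ B) → p * heads + q * tails ≤ tailsFirst p q h (suc t)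
    step (no d) _ = mix-≤ p+q≡1 0≤p 0≤q
      (ℚP.≤-trans (mono λ H _ → ℚP.≤-reflexive (cong (λ S → atLeast (suc t) ∣ S ∩ B ∣) (trans (addable-dep (H ∪ ⁅ x ⁆) x l T d) (addable-add T x∉l)))) rec)
      (ℚP.≤-trans (mono λ H _ → ℚP.≤-reflexive (cong (λ S → atLeast (suc t) ∣ S ∩ B ∣) (addable-dep H x l T d))) rec)
      where rec = tail-bound cap l T h (suc t) u (fresh ∘ there) room
    -- Outside `B` the toss still changes `T`, and with it later tests; the bound is uniform in `T`,
    -- so it covers both outcomes.
    step (yes i) (no x∉B) = mix-≤ p+q≡1 0≤p 0≤q
      (ℚP.≤-trans (heads-ind i) (tail-bound cap l (T ∪ ⁅ x ⁆) h (suc t) u fresh′ (subst (λ S → μ ℕ.≤ ∣ S ∣ ℕ.+ h) (sym (add-∩-∉ T x∉B)) room)))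
      (ℚP.≤-trans (mono λ H H⊆l → ℚP.≤-reflexive (cong (λ S → atLeast (suc t) ∣ S ∣)
        (trans (cong (_∩ B) (addable-∉ (x∉l ∘ H⊆l) i)) (add-∩-∉ (addable H l T) x∉B))))
        (tail-bound cap l T h (suc t) u (fresh ∘ there) room))
    step (yes i) (yes x∈B) = capacity h room
      where
      grown : suc ∣ T ∩ B ∣ ℕ.≤ μ
      grown = subst (ℕ._≤ μ) (∣add-∩∣ T x∈B x∉T) (cap (T ∪ ⁅ x ⁆) i)
      capacity : ∀ h → μ ℕ.≤ ∣ T ∩ B ∣ ℕ.+ h → p * heads + q * tails ≤ tailsFirst p q h (suc t)
      -- With no heads left `T` already fills `B`, so `x` could not fit.
      capacity zero room = contradiction (ℕP.≤-trans grown (subst (μ ℕ.≤_) (ℕP.+-identityʳ _) room)) ℕP.1+n≰n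
      capacity (suc h) room = ℚP.+-mono-≤
        (*-monoˡ p 0≤p (ℚP.≤-trans (heads-ind i) (tail-bound cap l (T ∪ ⁅ x ⁆) h (suc t) u fresh′
          (subst (λ k → μ ℕ.≤ k ℕ.+ h) (sym (∣add-∩∣ T x∈B x∉T)) (subst (μ ℕ.≤_) (ℕP.+-suc _ h) room)))))
        (*-monoˡ q 0≤q (ℚP.≤-trans
          (mono λ H H⊆l → subst (λ S → atLeast (suc t) ∣ S ∩ B ∣ ≤ atLeast t ∣ addable H l T ∩ B ∣) (sym (addable-∉ (x∉l ∘ H⊆l) i))
            (atLeast-mono (suc t) (∣add-∩∣≤ (addable H l T) x B)))
          (tail-bound cap l T (suc h) t u (fresh ∘ there) room)))

-- One representative member per capacity

module Largest (L : Laminar n) (e : Fin n) (k : ℕ) where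
  open Matroid L

  -- The empty set stands in when no member of capacity `k` contains `e`; it satisfies
  -- `big-capacity` trivially, so every capacity can be treated alike.
  Eligible : Subset n → Set
  Eligible B = B ≡ ⊥ ⊎ ((B , k) ∈ˡ family L × e ∈ B)

  -- The members of capacity k containing e form a chain.
  largest : ∀ cs → (∀ {c} → c ∈ˡ cs → c ∈ˡ family L) →
    Σ (Subset n) λ B → Eligible B × (∀ {A} → (A , k) ∈ˡ cs → e ∈ A → A ⊆ B)
  largest [] _ = ⊥ , inj₁ refl , λ ()
  largest ((C , j) ∷ cs) sub with largest cs (sub ∘ there) | j ℕ.≟ k | e ∈? C
  ... | B , el , top | no j≢k | _ = B , el , λ { (here refl) _ → contradiction refl j≢k ; (there A∈) → top A∈ }
  ... | B , el , top | yes _ | no e∉C = B , el , λ { (here refl) e∈ → contradiction e∈ e∉C ; (there A∈) → top A∈ }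
  ... | .⊥ , inj₁ refl , top | yes refl | yes e∈C = C , inj₂ (sub (here refl) , e∈C) ,
    λ { (here refl) _ z∈ → z∈ ; (there A∈) e∈A → contradiction (top A∈ e∈A e∈A) ∉⊥ }
  ... | B , inj₂ (B∈ , e∈B) , top | yes refl | yes e∈C with laminar-∈ (sub (here refl)) B∈
  ...   | inj₁ disj = contradiction (e , x∈p∩q⁺ (e∈C , e∈B)) disj
  ...   | inj₂ (inj₁ C⊆B) = B , inj₂ (B∈ , e∈B) , λ { (here refl) _ → C⊆B ; (there A∈) → top A∈ }
  ...   | inj₂ (inj₂ B⊆C) = C , inj₂ (sub (here refl) , e∈C) , λ { (here refl) _ z∈ → z∈ ; (there A∈) e∈A → B⊆C ∘ top A∈ e∈A }

  big : Subset n
  big = proj₁ (largest (family L) id)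

  ⊆-big : ∀ {A} → (A , k) ∈ˡ family L → e ∈ A → A ⊆ big
  ⊆-big = proj₂ (proj₂ (largest (family L) id))

  big-capacity : ∀ T → Independent L T → ∣ T ∩ big ∣ ℕ.≤ k
  big-capacity T i with proj₁ (proj₂ (largest (family L) id))
  ... | inj₁ big≡⊥ rewrite big≡⊥ | ∩-zeroʳ T | ∣⊥∣≡0 n = z≤n
  ... | inj₂ (big∈ , _) = All.lookup i big∈

maxCapacity : List (Constraint n) → ℕ
maxCapacity []             = 0
maxCapacity ((_ , k) ∷ cs) = k ℕ.⊔ maxCapacity cs

≤maxCapacity : ∀ {cs : List (Constraint n)} {c} → c ∈ˡ cs → proj₂ c ℕ.≤ maxCapacity cs
≤maxCapacity {cs = c ∷ cs} (here refl) = ℕP.m≤m⊔n (proj₂ c) (maxCapacity cs)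
≤maxCapacity {cs = c ∷ cs} (there c∈) = ℕP.≤-trans (≤maxCapacity c∈) (ℕP.m≤n⊔m (proj₂ c) (maxCapacity cs))

-- Acceptance along a run

module Online (L : Laminar n) (w : Weights n) where
  open Matroid L
  open Weight w

  optimum : Subset n
  optimum = scan ⊤ order ⊥

  ∈-order : ∀ e → e ∈ˡ order
  ∈-order e = ∈-resp-↭ order-↭ (∈-allFin e)

  before after rest : Fin n → List (Fin n)
  before e = proj₁ (∈-∃++ (∈-order e))
  after  e = proj₁ (proj₂ (∈-∃++ (∈-order e)))
  rest   e = before e ++ after e

  order-split : ∀ e → order ≡ before e ++ e ∷ after e
  order-split e = proj₂ (proj₂ (∈-∃++ (∈-order e)))

  allFin-↭-rest : ∀ e → allFin n ↭ e ∷ rest e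
  allFin-↭-rest e = ↭-trans (subst (allFin n ↭_) (order-split e) order-↭) (shift e (before e) (after e))

  rest-unique : ∀ e → Unique (e ∷ rest e)
  rest-unique e = Unique-resp-↭ (allFin-↭-rest e) (allFin⁺ n)

  M : ℕ
  M = maxCapacity (family L)

  -- Index `i` stands for capacity `suc i`. Scanning `rest e` makes the count independent of the
  -- coin of `e`.
  competitors : Fin n → ℕ → Subset n → ℕ
  competitors e i H = ∣ addable H (rest e) ⊥ ∩ Largest.big L e (suc i) ∣

  -- A linear substitute for the indicator that every count stays below its capacity: it never
  -- exceeds that indicator, and its expectation splits over the capacities.
  margin : Fin n → Subset n → ℚ
  margin e H = 1ℚ - ∑ (downFrom M) (λ i → atLeast (suc i) (competitors e i H))

  -- For e ∈ optimum and H the sample, at most the indicator of e ∈ ONLINE; it may be negative.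
  accept : Fin n → Subset n → ℚ
  accept e H = if does (e ∈? H) then 0ℚ else margin e H

  Improves : Subset n → Fin n → Set
  Improves H e = GREEDY L w (H ∪ ⁅ e ⁆) ≢ GREEDY L w H

  improves⇒addable : ∀ {H e} → e ∉ H → Improves H e → e ∈ addable H order ⊥
  improves⇒addable {H} {e} e∉H imp with e ∈? addable H order ⊥
  ... | yes e∈ = e∈
  ... | no e∉  = contradiction
    (trans (greedy-scan L (H ∪ ⁅ e ⁆)) (trans (scan-unaddable H order ⊥ e∉H e∉) (sym (greedy-scan L H)))) imp

  -- `e` enters the solution for the enlarged sample, whereas the solution for `H` consists of
  -- sampled elements only.
  addable⇒improves : ∀ {H e} → e ∉ H → e ∈ addable H order ⊥ → Improves H e
  addable⇒improves {H} {e} e∉H e∈ eq = scan-∉ H order ⊥ ∉⊥ e∉H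
    (subst (e ∈_) (trans (sym (greedy-scan L (H ∪ ⁅ e ⁆))) (trans eq (greedy-scan L H))) (addable-scan H order ⊥ e∉H e∈))

  optimum-independent : Independent L optimum
  optimum-independent = scan-ind ⊤ order ind-⊥

  module Run (H : Subset n) where

    -- A copy of the local `step` of `ONLINE`, with the sample as a parameter. The two agree
    -- definitionally, so `ONLINE≡run` only has to replace `toSet` by `setOf`.
    step : Subset n → Fin n → Subset n
    step ALG e =
      if not (does (≡-dec BoolP._≟_ (GREEDY L w (H ∪ ⁅ e ⁆)) (GREEDY L w H)))
         ∧ independent? L (ALG ∪ ⁅ e ⁆)
      then ALG ∪ ⁅ e ⁆ else ALG

    data Step (S : Subset n) (x : Fin n) : Subset n → Set where
      accepted : Improves H x → Independent L (S ∪ ⁅ x ⁆) → Step S x (S ∪ ⁅ x ⁆)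
      rejected : ¬ (Improves H x × Independent L (S ∪ ⁅ x ⁆)) → Step S x S

    step-view : ∀ S x → Step S x (step S x)
    step-view S x with ≡-dec BoolP._≟_ (GREEDY L w (H ∪ ⁅ x ⁆)) (GREEDY L w H) | ind? (S ∪ ⁅ x ⁆)
    ... | yes eq | _     = rejected λ { (imp , _) → imp eq }
    ... | no imp | yes i = accepted imp i
    ... | no _   | no d  = rejected λ { (_ , i) → d i }

    run : Subset n → List (Fin n) → Subset n
    run = foldl step

    run-⊇ : ∀ S l → S ⊆ run S l
    run-⊇ S []      y∈ = y∈
    run-⊇ S (x ∷ l) y∈ with step S x | step-view S x
    ... | _ | accepted _ _ = run-⊇ _ l (p⊆p∪q _ y∈)
    ... | _ | rejected _   = run-⊇ S l y∈

    run-independent : ∀ S l → Independent L S → Independent L (run S l)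
    run-independent S []      i = i
    run-independent S (x ∷ l) i with step S x | step-view S x
    ... | _ | accepted _ i′ = run-independent _ l i′
    ... | _ | rejected _    = run-independent S l i

    run-∈⁻ : ∀ S l {y} → y ∈ run S l → y ∈ S ⊎ (y ∈ˡ l × Improves H y)
    run-∈⁻ S []      y∈ = inj₁ y∈
    run-∈⁻ S (x ∷ l) {y} y∈ with step S x | step-view S x
    ... | _ | rejected _ with run-∈⁻ S l y∈
    ...   | inj₁ y∈S         = inj₁ y∈S
    ...   | inj₂ (y∈l , imp) = inj₂ (there y∈l , imp)
    run-∈⁻ S (x ∷ l) {y} y∈ | _ | accepted imp _ with run-∈⁻ _ l y∈
    ...   | inj₂ (y∈l , imp′) = inj₂ (there y∈l , imp′)
    ...   | inj₁ y∈S with x∈p∪q⁻ S _ y∈S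
    ...     | inj₁ y∈S′ = inj₁ y∈S′
    ...     | inj₂ y∈x with refl ← x∈⁅y⁆⇒x≡y _ y∈x = inj₂ (here refl , imp)

    -- Whatever arrived before `e`, the accepted elements are addable and differ from `e`. A member
    -- through `e` of capacity `suc i` lies in the representative for that capacity, so it holds at
    -- most `competitors e i H` of them, and room for `e` remains.
    run-accepts : ∀ {e} d₁ d₂ → Unique (d₁ ++ e ∷ d₂) → (∀ {y} → y ∈ˡ d₁ ++ e ∷ d₂ → y ∉ H) →
      e ∈ optimum → (∀ {i} → i ℕ.< M → competitors e i H ℕ.< suc i) → e ∈ run ⊥ (d₁ ++ e ∷ d₂)
    run-accepts {e} d₁ d₂ u disjoint e∈O few rewrite foldl-++ step ⊥ d₁ (e ∷ d₂) =
      run-⊇ (step S e) d₂ accepts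
      where
      S = run ⊥ d₁
      e∉H : e ∉ H
      e∉H = disjoint (∈-++⁺ʳ d₁ (here refl))
      improves : Improves H e
      improves = addable⇒improves e∉H (optimal-addable H order dominates-⊥ ∉⊥ e∉H e∈O)
      ⊆-addable : S ⊆ addable H (rest e) ⊥
      ⊆-addable {y} y∈ with run-∈⁻ ⊥ d₁ y∈
      ... | inj₁ y∈⊥ = contradiction y∈⊥ ∉⊥
      ... | inj₂ (y∈d₁ , imp) = addable-drop H (before e) (after e) ⊥ e∉H
        (subst (λ l → y ∈ addable H l ⊥) (order-split e) (improves⇒addable (disjoint (∈-++⁺ˡ y∈d₁)) imp))
        λ { refl → Unique-++-disjoint d₁ u y∈d₁ (here refl) }
      fits : ∀ {c} → c ∈ˡ family L → ∣ (S ∪ ⁅ e ⁆) ∩ proj₁ c ∣ ℕ.≤ proj₂ c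
      fits {C , k} c∈ with e ∈? C
      ... | no e∉C = subst (λ T → ∣ T ∣ ℕ.≤ k) (sym (add-∩-∉ S e∉C)) (All.lookup (run-independent ⊥ d₁ ind-⊥) c∈)
      -- As an element of the optimum, `e` is independent by itself, so `C` has positive capacity;
      -- this is why the sum over capacities starts at 1.
      ... | yes e∈C = within k c∈ (subst (ℕ._≤ k) (∣add-∩∣ ⊥ e∈C ∉⊥) (All.lookup (ind-⊆ (add-⊆ (λ y∈ → contradiction y∈ ∉⊥) e∈O) optimum-independent) c∈))
        where
        within : ∀ k → (C , k) ∈ˡ family L → suc ∣ ⊥ ∩ C ∣ ℕ.≤ k → ∣ (S ∪ ⁅ e ⁆) ∩ C ∣ ℕ.≤ k
        within (suc i) c∈ _ = begin
          ∣ (S ∪ ⁅ e ⁆) ∩ C ∣     ≤⟨ ∣add-∩∣≤ S e C ⟩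
          suc ∣ S ∩ C ∣           ≤⟨ s≤s (∩-mono-∣∣ ⊆-addable (Largest.⊆-big L e (suc i) c∈ e∈C)) ⟩
          suc (competitors e i H) ≤⟨ few (≤maxCapacity c∈) ⟩
          suc i                   ∎
          where open ℕP.≤-Reasoning
      accepts : e ∈ step S e
      accepts with step S e | step-view S e
      ... | _ | accepted _ _ = ∈-add⁺ S e
      ... | _ | rejected ¬ok = contradiction (improves , All.tabulate fits) ¬ok

  margin≤1 : ∀ e H → margin e H ≤ 1ℚ
  margin≤1 e H = subst (margin e H ≤_) (ℚP.+-identityʳ 1ℚ)
    (ℚP.+-monoʳ-≤ 1ℚ (ℚP.neg-antimono-≤ (0≤∑ (downFrom M) λ i → 0≤atLeast (suc i) (competitors e i H))))

  -- The left side depends on the order only through the sample set, as the passage to coins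
  -- requires. It is zero unless `e` is optimal and unsampled. Then either `run-accepts` applies and
  -- the margin is at most 1, or some count reaches its capacity and the margin is at most 0, which
  -- asks nothing of the run.
  ONLINE-accept : (∀ e → 0ℚ ≤ w e) → ∀ σ m → σ ↭ allFin n → ∀ e →
    val optimum e * accept e (setOf (take m σ)) ≤ val (ONLINE L w σ m) e
  ONLINE-accept w≥0 σ m σ↭ e = cases (e ∈? optimum) (e ∈? H)
    where
    H = setOf (take m σ)
    open Run H
    ONLINE≡run : ONLINE L w σ m ≡ run ⊥ (drop m σ)
    ONLINE≡run = cong (λ H → Run.run H ⊥ (drop m σ)) (toSet-setOf (take m σ))
    σ-unique : Unique (take m σ ++ drop m σ)
    σ-unique = subst Unique (sym (take++drop≡id m σ)) (Unique-resp-↭ (↭-sym σ↭) (allFin⁺ n))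
    e∈σ : e ∈ˡ take m σ ++ drop m σ
    e∈σ = subst (e ∈ˡ_) (sym (take++drop≡id m σ)) (∈-resp-↭ (↭-sym σ↭) (∈-allFin e))
    e∈drop : e ∉ H → e ∈ˡ drop m σ
    e∈drop e∉H with ∈-++⁻ (take m σ) e∈σ
    ... | inj₁ e∈take = contradiction (∈-setOf⁺ e∈take) e∉H
    ... | inj₂ e∈d = e∈d
    disjoint : ∀ {y} → y ∈ˡ drop m σ → y ∉ H
    disjoint y∈d y∈H = Unique-++-disjoint (take m σ) σ-unique (∈-setOf⁻ (take m σ) y∈H) y∈d
    accepted-if-few : e ∉ H → e ∈ optimum → (∀ {i} → i ℕ.< M → competitors e i H ℕ.< suc i) → e ∈ ONLINE L w σ m
    accepted-if-few e∉H e∈O few rewrite ONLINE≡run with ∈-∃++ (e∈drop e∉H)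
    ... | d₁ , d₂ , eq = subst (λ d → e ∈ run ⊥ d) (sym eq)
      (run-accepts d₁ d₂ (subst Unique eq (Unique-++⁻ʳ (take m σ) σ-unique)) (disjoint ∘ subst (_ ∈ˡ_) (sym eq)) e∈O few)
    cases : Dec (e ∈ optimum) → Dec (e ∈ H) → val optimum e * accept e H ≤ val (ONLINE L w σ m) e
    cases (no e∉O) _ = subst (_≤ val (ONLINE L w σ m) e)
      (sym (trans (cong (_* accept e H) (val-∉ {optimum} e∉O)) (ℚP.*-zeroˡ (accept e H)))) (0≤val w≥0 (ONLINE L w σ m) e)
    cases (yes _) (yes e∈H) = subst (_≤ val (ONLINE L w σ m) e)
      (sym (trans (cong (λ b → val optimum e * (if b then 0ℚ else margin e H)) (dec-true (e ∈? H) e∈H)) (ℚP.*-zeroʳ (val optimum e)))) (0≤val w≥0 (ONLINE L w σ m) e)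
    cases (yes e∈O) (no e∉H) = subst (_≤ val (ONLINE L w σ m) e)
      (sym (cong₂ (λ v b → v * (if b then 0ℚ else margin e H)) (val-∈ {optimum} e∈O) (dec-false (e ∈? H) e∉H)))
      (crowded (all-below-or-1≤∑ M (λ i → competitors e i H)))
      where
      open ℚP.≤-Reasoning
      crowded : (∀ {i} → i ℕ.< M → competitors e i H ℕ.< suc i) ⊎ 1ℚ ≤ ∑ (downFrom M) (λ i → atLeast (suc i) (competitors e i H)) →
        w e * margin e H ≤ val (ONLINE L w σ m) e
      crowded (inj₁ few) = begin
        w e * margin e H           ≤⟨ *-monoˡ (w e) (w≥0 e) (margin≤1 e H) ⟩
        w e * 1ℚ                   ≡⟨ ℚP.*-identityʳ (w e) ⟩
        w e                        ≡⟨ val-∈ {ONLINE L w σ m} (accepted-if-few e∉H e∈O few) ⟨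
        val (ONLINE L w σ m) e     ∎
      crowded (inj₂ 1≤) = begin
        w e * margin e H           ≤⟨ *-monoˡ (w e) (w≥0 e) (ℚP.≤-trans (ℚP.+-monoʳ-≤ 1ℚ (ℚP.neg-antimono-≤ 1≤)) (ℚP.≤-reflexive (ℚP.+-inverseʳ 1ℚ))) ⟩
        w e * 0ℚ                   ≡⟨ ℚP.*-zeroʳ (w e) ⟩
        0ℚ                         ≤⟨ 0≤val w≥0 (ONLINE L w σ m) e ⟩
        val (ONLINE L w σ m) e     ∎

-≡-1* : ∀ x → - x ≡ - 1ℚ * x
-≡-1* x = trans (cong -_ (sym (ℚP.*-identityˡ x))) (ℚP.neg-distribˡ-* 1ℚ x)

-- Expectations and the constant

open Coins 5/6ℚ 1/6ℚ

-- The coin of `e` is tossed first. Heads contribute zero; tails have probability `1/6` and leave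
-- the expected margin, which is at least `1 - 3/8`.
𝔼-accept : ∀ (L : Laminar n) (w : Weights n) e → + 5 / 48 ≤ 𝔼 (allFin n) (Online.accept L w e)
𝔼-accept {n} L w e = begin
  + 5 / 48                                                     ≡⟨⟩
  0ℚ + 1/6ℚ * (1ℚ - + 3 / 8)                                   ≤⟨ ℚP.+-monoʳ-≤ 0ℚ (*-monoˡ 1/6ℚ 0≤1/6 (ℚP.+-monoʳ-≤ 1ℚ (ℚP.neg-antimono-≤ blocked))) ⟩
  0ℚ + 1/6ℚ * (1ℚ - ∑ (downFrom M) (λ i → 𝔼 l (bad i)))        ≡⟨ cong (λ z → 0ℚ + 1/6ℚ * z) 𝔼-margin ⟨
  0ℚ + 1/6ℚ * 𝔼 l (margin e)                                   ≡⟨ cong (_+ 1/6ℚ * 𝔼 l (margin e)) sampled ⟨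
  5/6ℚ * 𝔼 l (λ H → accept e (H ∪ ⁅ e ⁆)) + 1/6ℚ * 𝔼 l (margin e)
    ≤⟨ ℚP.+-monoʳ-≤ (5/6ℚ * 𝔼 l (λ H → accept e (H ∪ ⁅ e ⁆))) (*-monoˡ 1/6ℚ 0≤1/6 (𝔼-mono refl 0≤5/6 0≤1/6 l unsampled)) ⟩
  5/6ℚ * 𝔼 l (λ H → accept e (H ∪ ⁅ e ⁆)) + 1/6ℚ * 𝔼 l (accept e)
    ≡⟨ 𝔼-↭ (allFin-↭-rest e) (accept e) ⟨
  𝔼 (allFin n) (accept e) ∎
  where
  open ℚP.≤-Reasoning
  open Online L w
  l = rest e
  bad : ℕ → Subset n → ℚ
  bad i H = atLeast (suc i) (competitors e i H)
  unique-l : ∀ {y} → y ∈ˡ l → e ≢ y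
  unique-l with rest-unique e
  ... | e≢ ∷ _ = All.lookup e≢
  blocked : ∑ (downFrom M) (λ i → 𝔼 l (bad i)) ≤ + 3 / 8
  blocked with rest-unique e
  -- The scan starts from the empty set, so heads have all `suc i` units of capacity to use up.
  ... | _ ∷ u = ℚP.≤-trans (∑-mono (downFrom M) λ {i} _ →
    Tails.tail-bound L 5/6ℚ 1/6ℚ refl 0≤5/6 0≤1/6 (Largest.big-capacity L e (suc i)) l ⊥ (suc i) (suc i) u (λ _ → ∉⊥) (ℕP.m≤n+m (suc i) _))
    (∑-tailsFirst M)
  𝔼-margin : 𝔼 l (margin e) ≡ 1ℚ - ∑ (downFrom M) (λ i → 𝔼 l (bad i))
  𝔼-margin = begin-equality
    𝔼 l (margin e)
      ≡⟨ 𝔼-+ l ⟩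
    𝔼 l (λ _ → 1ℚ) + 𝔼 l (λ H → - ∑ (downFrom M) (λ i → bad i H))
      ≡⟨ cong₂ _+_ (𝔼-const refl 0≤5/6 0≤1/6 l 1ℚ) (trans (𝔼-cong l λ H → -≡-1* (∑ (downFrom M) (λ i → bad i H))) (𝔼-*ˡ l (- 1ℚ))) ⟩
    1ℚ + - 1ℚ * 𝔼 l (λ H → ∑ (downFrom M) (λ i → bad i H))
      ≡⟨ cong (λ z → 1ℚ + z) (sym (-≡-1* (𝔼 l (λ H → ∑ (downFrom M) (λ i → bad i H))))) ⟩
    1ℚ - 𝔼 l (λ H → ∑ (downFrom M) (λ i → bad i H))
      ≡⟨ cong (λ z → 1ℚ - z) (𝔼-∑ l (downFrom M) bad) ⟩
    1ℚ - ∑ (downFrom M) (λ i → 𝔼 l (bad i)) ∎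
  sampled : 5/6ℚ * 𝔼 l (λ H → accept e (H ∪ ⁅ e ⁆)) ≡ 0ℚ
  sampled = trans (cong (λ z → 5/6ℚ * z) (trans
    (𝔼-cong l λ H → cong (λ b → if b then 0ℚ else margin e (H ∪ ⁅ e ⁆)) (dec-true (e ∈? (H ∪ ⁅ e ⁆)) (∈-add⁺ H e)))
    (𝔼-zero l))) (ℚP.*-zeroʳ 5/6ℚ)
  unsampled : ∀ H → (∀ {y} → y ∈ H → y ∈ˡ l) → margin e H ≤ accept e H
  unsampled H H⊆l = ℚP.≤-reflexive (sym (cong (λ b → if b then 0ℚ else margin e H) (dec-false (e ∈? H) λ e∈ → unique-l (H⊆l e∈) refl)))

-- Only elements of the greedy optimum are credited; by linearity their common acceptance bound
-- carries over to the total value.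
expectedValue-bound : ∀ (L : Laminar n) (w : Weights n) → (∀ e → 0ℚ ≤ w e) →
  (+ 5 / 48) * f w (Online.optimum L w) ≤ expectedValue 5/6ℚ L w
expectedValue-bound {n} L w w≥0 = begin
  (+ 5 / 48) * f w optimum
    ≡⟨ cong (λ z → (+ 5 / 48) * z) (f-∑ optimum) ⟩
  (+ 5 / 48) * ∑ (allFin n) (val optimum)
    ≡⟨ ∑-*ˡ (allFin n) (+ 5 / 48) ⟨
  ∑ (allFin n) (λ e → (+ 5 / 48) * val optimum e)
    ≤⟨ ∑-mono (allFin n) (λ {e} _ → ℚP.≤-trans (*-monoʳ (val optimum e) (0≤val w≥0 optimum e) (𝔼-accept L w e)) (ℚP.≤-reflexive (ℚP.*-comm _ (val optimum e)))) ⟩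
  ∑ (allFin n) (λ e → val optimum e * 𝔼 (allFin n) (accept e))
    ≡⟨ ∑-cong (allFin n) (λ {e} _ → 𝔼-*ˡ (allFin n) (val optimum e)) ⟨
  ∑ (allFin n) (λ e → 𝔼 (allFin n) (λ H → val optimum e * accept e H))
    ≡⟨ 𝔼-∑ (allFin n) (allFin n) (λ e H → val optimum e * accept e H) ⟨
  𝔼 (allFin n) Φ
    ≡⟨ ∑-permutations-binom n Φ (binom 5/6ℚ n) (λ _ → refl) ⟨
  1/n! * ∑ perms (λ σ → ∑ (upTo (suc n)) (λ m → binom 5/6ℚ n m * Φ (setOf (take m σ))))
    ≤⟨ *-monoˡ 1/n! 0≤1/n! (∑-mono perms λ {σ} σ∈ → ∑-mono (upTo (suc n)) λ {m} _ → *-monoˡ (binom 5/6ℚ n m) (0≤binom m) (value σ∈ m)) ⟩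
  1/n! * ∑ perms (λ σ → ∑ (upTo (suc n)) (λ m → binom 5/6ℚ n m * f w (ONLINE L w σ m)))
    ≡⟨ cong (λ z → 1/n! * z) (trans (sumℚ-∑ perms _) (∑-cong perms λ {σ} _ → sumℚ-∑ (upTo (suc n)) _)) ⟨
  expectedValue 5/6ℚ L w ∎
  where
  open ℚP.≤-Reasoning
  open Online L w
  open Weight w
  1/n! = (+ 1 / (n !)) {{n ℕP.!≢0}}
  perms = permutations (allFin n)
  Φ : Subset n → ℚ
  Φ H = ∑ (allFin n) (λ e → val optimum e * accept e H)
  0≤1/n! : 0ℚ ≤ 1/n!
  0≤1/n! = ℚP.nonNegative⁻¹ 1/n! {{ℚP.normalize-nonNeg 1 (n !) {{n ℕP.!≢0}}}}
  0≤binom : ∀ m → 0ℚ ≤ binom 5/6ℚ n m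
  0≤binom m = 0≤* (0≤fromℕℚ (n C m)) (0≤* (0≤^ 0≤5/6 m) (0≤^ 0≤1/6 (n ∸ m)))
  value : ∀ {σ} → σ ∈ˡ perms → ∀ m → Φ (setOf (take m σ)) ≤ f w (ONLINE L w σ m)
  value {σ} σ∈ m = subst (Φ (setOf (take m σ)) ≤_) (sym (f-∑ (ONLINE L w σ m)))
    (∑-mono (allFin n) λ {e} _ → ONLINE-accept w≥0 σ m (permutations-↭ (allFin n) σ∈) e)

theorem3 : Σ ℚ (λ p → (0ℚ < p) × (p < 1ℚ) ×
    ((n : ℕ) (L : Laminar n) (w : Weights n) → (∀ e → 0ℚ ≤ w e) →
    (T : Subset n) → Independent L T →
    (+ 5 / 48) * f w T ≤ expectedValue p L w))
theorem3 = 5/6ℚ , from-yes (0ℚ ℚP.<? 5/6ℚ) , from-yes (5/6ℚ ℚP.<? 1ℚ) , λ n L w w≥0 T iT →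
  ℚP.≤-trans (*-monoˡ (+ 5 / 48) (from-yes (0ℚ ℚP.≤? + 5 / 48)) (Weight.greedy-optimal w L w≥0 T iT))
    (expectedValue-bound L w w≥0)
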